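{- Let $\mathscr D=\{d_1,\ldots,d_n\}$ be a set of positive integers with $d_1>d_2>\cdots>d_n$. Define a sequence $\overline{\mathbf s}$ as follows. Case (a): $\sigma(\mathscr D)$ is even or $d_n$ is odd. Let $\mathbf s=d_1,\ldots,d_n$, $c=\max_{1\le k\le n-1}\left\lceil \frac{ -\Delta_{\mathbf s}(k)}{\min\{k,d_n\}}\right\rceil$, and $C^{\star}=c$ if $d_n$ and $\sigma(\mathscr D)$ are even or if $d_n$ is odd and $\sigma(\mathscr D)+cd_n$ is even, while $C^{\star}=c+1$ if $d_n$ and $\sigma(\mathscr D)+cd_n$ are odd. Set $\overline{\mathbf s}=d_1,\ldots,d_{n-1},(d_n)_{C^{\star}+1}$. Case (b): $\sigma(\mathscr D)$ is odd and $d_n$ is even. Let $r=\max\{i:d_i\text{ odd}\}$, $\mathbf s=d_1,\ldots,d_{r-1},(d_r)_2,d_{r+1},\ldots,d_n$, $C^{\star}=\max_{1\le k\le n}\left\lceil \frac{ -\Delta_{\mathbf s}(k)}{\min\{k,d_n\}}\right\rceil$, and let $\overline{\mathbf s}$ be $\mathbf s$ followed by $C^{\star}$ further copies of $d_n$. Then $\overline{\mathbf s}$ is a graphic sequence with set of distinct terms $\mathscr D$, and \[ \tfrac12\sigma(\overline{\mathbf s})-\ell_q(\mathscr D)<\min\mathscr D. \]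
   Context: All graphs are finite and simple. A nonincreasing sequence $a_1,\ldots,a_p$ of nonnegative integers is graphic if there is a simple graph with vertices $v_1,\ldots,v_p$ such that $\deg v_k=a_k$ for each $k$. The degree set of a graph is the set of distinct degrees of its vertices. For a finite nonempty set $\mathscr D$ of positive integers, $\ell_q(\mathscr D)$ denotes the least number of edges of a simple graph whose degree set is exactly $\mathscr D$. The notation $(d)_m$ denotes $m$ consecutive occurrences of $d$ in a sequence. $\sigma(\mathscr D)$ is the sum of the elements of $\mathscr D$ and $\sigma(\overline{\mathbf s})$ the sum of the terms of $\overline{\mathbf s}$. For a sequence $\mathbf s=a_1,\ldots,a_p$ and $1\le k\le p$, $\Delta_{\mathbf s}(k)=k(k-1)+\sum_{i=k+1}^{p}\min\{k,a_i\}-\sum_{i=1}^{k}a_i$.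
   Formalization: The set 𝒟 is assumed to have at least two elements (n ≥ 2), because for n = 1 the maximum over 1 ≤ k ≤ n−1 that defines c in Case (a) is over an empty range and the sequence is undefined. -}

module Defs where

open import Data.Bool using (Bool; true; false; if_then_else_; _∧_; _∨_; not)
open import Data.Nat as ℕ using (ℕ; zero; suc; _+_; _*_; _∸_; _⊓_; _<ᵇ_; _≡ᵇ_; _%_; _≥_)
open import Data.Integer as ℤ using (ℤ; +_; -_; _/ℕ_; _⊔_)
open import Data.Fin using (Fin; toℕ)
open import Data.List using (List; []; _∷_; _++_; [_]; map; take; drop; replicate; length; upTo; allFin; lookup)
open import Data.List.Membership.Propositional using (_∈_)
open import Data.Nat.ListAction using (sum)
open import Data.List.Relation.Unary.Linked using (Linked)
open import Data.Product using (Σ; ∃; _×_)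
open import Relation.Binary.PropositionalEquality using (_≡_)

record SimpleGraph (p : ℕ) : Set where
  field
    adj   : Fin p → Fin p → Bool
    sym   : ∀ i j → adj i j ≡ adj j i
    irrefl : ∀ i → adj i i ≡ false
open SimpleGraph public

degree : ∀ {p} → SimpleGraph p → Fin p → ℕ
degree {p} G i = sum (map (λ j → if adj G i j then 1 else 0) (allFin p))

edges : ∀ {p} → SimpleGraph p → ℕ
edges {p} G =
  sum (map (λ i → sum (map (λ j → if adj G i j ∧ (toℕ i <ᵇ toℕ j) then 1 else 0)
                            (allFin p)))
           (allFin p))

HasDegreeSet : ∀ {p} → SimpleGraph p → List ℕ → Set
HasDegreeSet {p} G D =
  (∀ v → degree G v ∈ D) × (∀ d → d ∈ D → ∃ λ v → degree G v ≡ d)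

IsLq : List ℕ → ℕ → Set
IsLq D ℓ =
  (Σ ℕ λ p → Σ (SimpleGraph p) λ G → HasDegreeSet G D × edges G ≡ ℓ)
  × (∀ p (G : SimpleGraph p) → HasDegreeSet G D → ℓ ℕ.≤ edges G)

Graphic : List ℕ → Set
Graphic s =
  Linked _≥_ s ×
  (Σ (SimpleGraph (length s)) λ G → ∀ k → degree G k ≡ lookup s k)

evenᵇ : ℕ → Bool
evenᵇ n = (n % 2) ≡ᵇ 0

-- ⌈ a / b ⌉ for b > 0 (junk value 0 when b = 0, never used)
ceilDiv : ℤ → ℕ → ℤ
ceilDiv a zero    = + 0
ceilDiv a (suc b) = - ((- a) /ℕ suc b)

Δ : List ℕ → ℕ → ℤ
Δ s k = + (k * (k ∸ 1)) ℤ.+ + sum (map (k ⊓_) (drop k s)) ℤ.- + sum (take k s)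

-- max_{1 ≤ k ≤ m} f k   (used only with m ≥ 1)
maxK : (ℕ → ℤ) → ℕ → ℤ
maxK f m = Data.List.foldr (λ k acc → f k ⊔ acc) (f 1) (map suc (upTo m))

term : List ℕ → ℕ → ℕ → ℤ
term s dn k = ceilDiv (- Δ s k) (k ⊓ dn)

-- r = max{ i : d_i odd } (1-based; 0 if there is no odd term)
lastOddPos : List ℕ → ℕ
lastOddPos []       = 0
lastOddPos (x ∷ xs) with lastOddPos xs
... | zero  = if evenᵇ x then 0 else 1
... | suc r = suc (suc r)

sbarA : List ℕ → ℕ → List ℕ
sbarA xs dn =
  let D  = xs ++ [ dn ]
      n  = length D
      s  = D
      c  = ℤ.∣ maxK (term s dn) (n ∸ 1) ∣
      C⋆ = if evenᵇ dn then c
           else (if evenᵇ (sum D + c * dn) then c else suc c)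
  in xs ++ replicate (C⋆ + 1) dn

sbarB : List ℕ → ℕ → List ℕ
sbarB xs dn =
  let D  = xs ++ [ dn ]
      n  = length D
      r  = lastOddPos D
      s  = take r D ++ drop (r ∸ 1) D
      C⋆ = ℤ.∣ maxK (term s dn) n ∣
  in s ++ replicate C⋆ dn

sbar : List ℕ → ℕ → List ℕ
sbar xs dn =
  if evenᵇ (sum (xs ++ [ dn ])) ∨ not (evenᵇ dn) then sbarA xs dn else sbarB xs dn

{-# OPTIONS --safe #-}

-- Choudum's induction gives the sufficiency of the Erdős–Gallai inequalities Δ(k) ≥ 0. Appending C
-- copies of d = min D to s adds C min(k, d) to Δ(k) for every k before the final run of d's, so C⋆ copies
-- make these Δ(k) nonnegative; along the run Δ does not decrease, as there are more than d terms.
--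
-- For the bound, let a graph G with degree set D have vertices whose degrees dominate s termwise (in case
-- (b) a second odd-degree vertex exists by parity). The inequality for the first k of these vertices, and
-- d min(k, y) ≤ min(k, d) y for y ≥ d, give −Δ(k) d ≤ min(k, d) (2 |E(G)| − σ(s)). At a k attaining the
-- maximum c this is (c − 1) d < 2 |E(G)| − σ(s).
module Submission where

open import Defs hiding (sym)
open import Data.Bool using (Bool; true; false; not; if_then_else_; _∧_; _∨_)
open import Data.Fin as Fin using (Fin; toℕ)
open import Data.Fin.Properties using (toℕ-injective; toℕ<n)
import Data.Integer as ℤ
import Data.Integer.DivMod as ℤ
import Data.Integer.Properties as ℤ
import Data.Integer.Tactic.RingSolver as ℤ-Solver
open import Data.List using (List; []; _∷_; _++_; [_]; map; take; drop; replicate; length; upTo; allFin; lookup; foldr; tabulate)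
open import Data.List.Membership.Propositional using (_∈_)
open import Data.List.Membership.Propositional.Properties using (∈-∃++; ∈-++⁻; ∈-++⁺ˡ; ∈-++⁺ʳ; ∈-map⁺; ∈-map⁻; ∈-upTo⁺; ∈-upTo⁻; ∈-allFin)
open import Data.List.Properties using (map-id; map-tabulate; map-cong; map-∘; map-++; map-replicate; length-map; length-++; length-take; length-drop; length-replicate; take-map; drop-map; take++drop≡id; ++-assoc)
open import Data.List.Relation.Binary.Permutation.Propositional using (_↭_; prep; ↭-refl; ↭-sym; ↭-trans; ↭-reflexive)
open import Data.List.Relation.Binary.Permutation.Propositional.Properties using (map⁺; shift)
open import Data.List.Relation.Binary.Pointwise as Pointwise using (Pointwise; []; _∷_)
open import Data.List.Relation.Unary.All as All using (All; []; _∷_)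
import Data.List.Relation.Unary.All.Properties as All
import Data.List.Relation.Unary.AllPairs as AllPairs
open import Data.List.Relation.Unary.Any using (here; there)
open import Data.List.Relation.Unary.Linked as Linked using (Linked; []; [-]; _∷_)
open import Data.List.Relation.Unary.Linked.Properties using (Linked⇒AllPairs)
open import Data.List.Relation.Unary.Unique.Propositional using (Unique; []; _∷_)
import Data.List.Relation.Unary.Unique.Propositional.Properties as Unique
open import Data.Nat
open import Data.Nat.ListAction using (sum)
open import Data.Nat.ListAction.Properties using (sum-++; sum-↭)
open import Data.Nat.Properties
open import Data.Nat.Tactic.RingSolver using (solve-∀)
open import Data.Product using (Σ; ∃; ∃₂; _×_; _,_; proj₁; proj₂)
open import Data.Sum using (_⊎_; inj₁; inj₂; [_,_]′)
open import Function using (_∘_; id)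
open import Function.Bundles using (_⇔_; mk⇔; Equivalence)
open import Relation.Binary.Definitions using (tri<; tri≈; tri>)
open import Relation.Binary.PropositionalEquality using (_≡_; _≢_; refl; sym; trans; cong; cong₂; subst; subst₂; module ≡-Reasoning)
open import Relation.Nullary using (yes; no; contradiction)

-- Sums over initial segments of ℕ

-- Copies of d are the right padding because `min(k, y) / y`, the gain in Δ(k) per unit of degree
-- sum, is largest over y ≥ d at y = d. No graph with degree set D can therefore repair a deficit of
-- Δ(k) more cheaply, and only rounding is lost. The ceiling costs less than one copy of d and the
-- parity correction at most one more, so σ of the constructed sequence exceeds 2 |E(G)| by less
-- than 2d; halving gives min D. The maximum c is nonnegative because the n elements of D are
-- distinct and positive: the largest is at least n, so Δ(1) ≤ 0. In the induction for sufficiency,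
-- the delicate k are those inside the initial run. There the first k terms keep their values while
-- both lowered terms lie in the tail, so the right side may lose two units. The missing slack comes
-- from parity when the run has height k, and from comparing the inequalities at k and k + 1 when
-- the run is higher.

∑ : ℕ → (ℕ → ℕ) → ℕ
∑ zero    f = 0
∑ (suc n) f = f 0 + ∑ n (f ∘ suc)

∑-cong : ∀ n {f g} → (∀ i → i < n → f i ≡ g i) → ∑ n f ≡ ∑ n g
∑-cong zero    f≡g = refl
∑-cong (suc n) f≡g = cong₂ _+_ (f≡g 0 z<s) (∑-cong n λ i i<n → f≡g (suc i) (s<s i<n))

∑-mono-≤ : ∀ n {f g} → (∀ i → i < n → f i ≤ g i) → ∑ n f ≤ ∑ n g
∑-mono-≤ zero    f≤g = z≤n
∑-mono-≤ (suc n) f≤g = +-mono-≤ (f≤g 0 z<s) (∑-mono-≤ n λ i i<n → f≤g (suc i) (s<s i<n))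

∑-distrib-+ : ∀ n f g → ∑ n (λ i → f i + g i) ≡ ∑ n f + ∑ n g
∑-distrib-+ zero    f g = refl
∑-distrib-+ (suc n) f g = trans (cong (f 0 + g 0 +_) (∑-distrib-+ n (f ∘ suc) (g ∘ suc)))
                                (lemma (f 0) (g 0) (∑ n (f ∘ suc)) (∑ n (g ∘ suc)))
  where
  lemma : ∀ a b c d → a + b + (c + d) ≡ a + c + (b + d)
  lemma = solve-∀

∑-distribˡ-* : ∀ n c f → ∑ n (λ i → c * f i) ≡ c * ∑ n f
∑-distribˡ-* zero    c f = sym (*-zeroʳ c)
∑-distribˡ-* (suc n) c f = trans (cong (c * f 0 +_) (∑-distribˡ-* n c (f ∘ suc)))
                                 (sym (*-distribˡ-+ c (f 0) _))

∑-const : ∀ n c → ∑ n (λ _ → c) ≡ n * c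
∑-const zero    c = refl
∑-const (suc n) c = cong (c +_) (∑-const n c)

∑-split : ∀ m n f → ∑ (m + n) f ≡ ∑ m f + ∑ n (λ i → f (m + i))
∑-split zero    n f = refl
∑-split (suc m) n f = trans (cong (f 0 +_) (∑-split m n (f ∘ suc))) (sym (+-assoc (f 0) _ _))

∑-snoc : ∀ n f → ∑ (suc n) f ≡ ∑ n f + f n
∑-snoc zero    f = +-identityʳ (f 0)
∑-snoc (suc n) f = trans (cong (f 0 +_) (∑-snoc n (f ∘ suc))) (sym (+-assoc (f 0) _ _))

∑-<⇒∃ : ∀ n f g → ∑ n f < ∑ n g → ∃ λ i → i < n × f i < g i
∑-<⇒∃ (suc n) f g f<g with f 0 <? g 0
... | yes p = 0 , z<s , p
... | no ¬p with ∑-<⇒∃ n (f ∘ suc) (g ∘ suc)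
                   (+-cancelˡ-< (f 0) _ _ (<-≤-trans f<g (+-monoˡ-≤ _ (≮⇒≥ ¬p))))
...   | i , i<n , lt = suc i , s<s i<n , lt

δ : ℕ → ℕ → ℕ
δ zero    zero    = 1
δ zero    (suc _) = 0
δ (suc _) zero    = 0
δ (suc x) (suc i) = δ x i

δ-refl : ∀ x → δ x x ≡ 1
δ-refl zero    = refl
δ-refl (suc x) = δ-refl x

δ-≢ : ∀ x i → x ≢ i → δ x i ≡ 0
δ-≢ zero    zero    x≢i = contradiction refl x≢i
δ-≢ zero    (suc i) x≢i = refl
δ-≢ (suc x) zero    x≢i = refl
δ-≢ (suc x) (suc i) x≢i = δ-≢ x i (x≢i ∘ cong suc)

δ≤1 : ∀ x i → δ x i ≤ 1
δ≤1 zero    zero    = ≤-refl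
δ≤1 zero    (suc i) = z≤n
δ≤1 (suc x) zero    = z≤n
δ≤1 (suc x) (suc i) = δ≤1 x i

∑-δ : ∀ n x → x < n → ∑ n (δ x) ≡ 1
∑-δ (suc n) zero    x<n = cong suc (trans (∑-const n 0) (*-zeroʳ n))
∑-δ (suc n) (suc x) x<n = ∑-δ n x (s<s⁻¹ x<n)

∑-δ-outside : ∀ n x → n ≤ x → ∑ n (δ x) ≡ 0
∑-δ-outside zero    x       n≤x = refl
∑-δ-outside (suc n) (suc x) n≤x = ∑-δ-outside n x (s≤s⁻¹ n≤x)

-- Adjacency matrices

-- ε x y is the adjacency matrix of the single edge xy.
ε : ℕ → ℕ → ℕ → ℕ → ℕ
ε x y i j = δ x i * δ y j + δ y i * δ x j

ε-sym : ∀ x y i j → ε x y i j ≡ ε x y j i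
ε-sym x y i j = lemma (δ x i) (δ y j) (δ y i) (δ x j)
  where
  lemma : ∀ a b c d → a * b + c * d ≡ d * c + b * a
  lemma = solve-∀

ε-outside : ∀ x y i j → x ≢ i → y ≢ i → ε x y i j ≡ 0
ε-outside x y i j x≢i y≢i = cong₂ (λ a b → a * δ y j + b * δ x j) (δ-≢ x i x≢i) (δ-≢ y i y≢i)

ε-source : ∀ x y j → x ≢ y → ε x y x j ≡ δ y j
ε-source x y j x≢y = trans (cong₂ (λ a b → a * δ y j + b * δ x j) (δ-refl x) (δ-≢ y x (x≢y ∘ sym)))
                           (trans (+-identityʳ _) (+-identityʳ _))

ε-target : ∀ x y j → x ≢ y → ε x y y j ≡ δ x j
ε-target x y j x≢y = trans (cong₂ (λ a b → a * δ y j + b * δ x j) (δ-≢ x y x≢y) (δ-refl y))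
                           (+-identityʳ _)

ε-support : ∀ x y i j → x ≢ y →
            ε x y i j ≡ 0 ⊎ (ε x y i j ≡ 1 × ((i ≡ x × j ≡ y) ⊎ (i ≡ y × j ≡ x)))
ε-support x y i j x≢y with x ≟ i | y ≟ i
... | no x≢i   | no y≢i   = inj₁ (ε-outside x y i j x≢i y≢i)
... | yes refl | yes refl = contradiction refl x≢y
... | yes refl | no _ with y ≟ j
...   | yes refl = inj₂ (trans (ε-source x y y x≢y) (δ-refl y) , inj₁ (refl , refl))
...   | no y≢j   = inj₁ (trans (ε-source x y j x≢y) (δ-≢ y j y≢j))
ε-support x y i j x≢y | no _ | yes refl with x ≟ j
...   | yes refl = inj₂ (trans (ε-target x y x x≢y) (δ-refl x) , inj₂ (refl , refl))
...   | no x≢j   = inj₁ (trans (ε-target x y j x≢y) (δ-≢ x j x≢j))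

ε-diag : ∀ x y i → x ≢ y → ε x y i i ≡ 0
ε-diag x y i x≢y with ε-support x y i i x≢y
... | inj₁ eq                        = eq
... | inj₂ (_ , inj₁ (refl , refl)) = contradiction refl x≢y
... | inj₂ (_ , inj₂ (refl , refl)) = contradiction refl x≢y

∑-ε : ∀ n x y i → x < n → y < n → ∑ n (ε x y i) ≡ δ x i + δ y i
∑-ε n x y i x<n y<n = begin
  ∑ n (ε x y i)                                              ≡⟨ ∑-distrib-+ n _ _ ⟩
  ∑ n (λ j → δ x i * δ y j) + ∑ n (λ j → δ y i * δ x j)      ≡⟨ cong₂ _+_ (∑-distribˡ-* n (δ x i) (δ y)) (∑-distribˡ-* n (δ y i) (δ x)) ⟩
  δ x i * ∑ n (δ y) + δ y i * ∑ n (δ x)                      ≡⟨ cong₂ (λ a b → δ x i * a + δ y i * b) (∑-δ n y y<n) (∑-δ n x x<n) ⟩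
  δ x i * 1 + δ y i * 1                                      ≡⟨ cong₂ _+_ (*-identityʳ (δ x i)) (*-identityʳ (δ y i)) ⟩
  δ x i + δ y i                                              ∎
  where open ≡-Reasoning

-- Indices range over all of ℕ and entries outside the first n columns vanish, so that changing an
-- edge is pointwise addition of `ε` and no `Fin` arithmetic enters the induction.
record Adjacency (n : ℕ) : Set where
  field
    entry     : ℕ → ℕ → ℕ
    entry≤1   : ∀ i j → entry i j ≤ 1
    symmetric : ∀ i j → entry i j ≡ entry j i
    loopless  : ∀ i → entry i i ≡ 0
    bounded   : ∀ i j → n ≤ j → entry i j ≡ 0

  valency : ℕ → ℕ
  valency i = ∑ n (entry i)

open Adjacency

Realised : ℕ → (ℕ → ℕ) → Set
Realised n a = Σ (Adjacency n) λ G → ∀ i → i < n → valency G i ≡ a i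

ε-bounded : ∀ n x y i j → x < n → y < n → n ≤ j → ε x y i j ≡ 0
ε-bounded n x y i j x<n y<n n≤j =
  trans (ε-sym x y i j) (ε-outside x y j i (<⇒≢ (<-≤-trans x<n n≤j)) (<⇒≢ (<-≤-trans y<n n≤j)))

addEdge : ∀ {n} (G : Adjacency n) x y → x < n → y < n → x ≢ y → entry G x y ≡ 0 →
          Σ (Adjacency n) λ H → ∀ i j → entry H i j ≡ entry G i j + ε x y i j
addEdge {n} G x y x<n y<n x≢y xy≡0 = H , λ _ _ → refl
  where
  H : Adjacency n
  entry     H i j = entry G i j + ε x y i j
  entry≤1   H i j with ε-support x y i j x≢y
  ... | inj₁ eq rewrite eq | +-identityʳ (entry G i j) = entry≤1 G i j
  ... | inj₂ (eq , inj₁ (refl , refl)) rewrite eq | xy≡0 = ≤-refl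
  ... | inj₂ (eq , inj₂ (refl , refl)) rewrite eq | symmetric G y x | xy≡0 = ≤-refl
  symmetric H i j = cong₂ _+_ (symmetric G i j) (ε-sym x y i j)
  loopless  H i   = cong₂ _+_ (loopless G i) (ε-diag x y i x≢y)
  bounded   H i j n≤j = cong₂ _+_ (bounded G i j n≤j) (ε-bounded n x y i j x<n y<n n≤j)

-- The additive form presents G as H with the edge added, so `valency-addEdge` covers removal too.
removeEdge : ∀ {n} (G : Adjacency n) x y → x ≢ y → 1 ≤ entry G x y →
             Σ (Adjacency n) λ H → ∀ i j → entry H i j + ε x y i j ≡ entry G i j
removeEdge {n} G x y x≢y 1≤xy = H , λ i j → m∸n+n≡m (ε≤entry i j)
  where
  ε≤entry : ∀ i j → ε x y i j ≤ entry G i j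
  ε≤entry i j with ε-support x y i j x≢y
  ... | inj₁ eq rewrite eq = z≤n
  ... | inj₂ (eq , inj₁ (refl , refl)) rewrite eq = 1≤xy
  ... | inj₂ (eq , inj₂ (refl , refl)) rewrite eq | symmetric G y x = 1≤xy
  H : Adjacency n
  entry     H i j = entry G i j ∸ ε x y i j
  entry≤1   H i j = ≤-trans (m∸n≤m _ (ε x y i j)) (entry≤1 G i j)
  symmetric H i j = cong₂ _∸_ (symmetric G i j) (ε-sym x y i j)
  loopless  H i   = trans (cong (_∸ ε x y i i) (loopless G i)) (0∸n≡0 (ε x y i i))
  bounded   H i j n≤j = trans (cong (_∸ ε x y i j) (bounded G i j n≤j)) (0∸n≡0 (ε x y i j))

valency-addEdge : ∀ {n} (G H : Adjacency n) x y → x < n → y < n →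
                  (∀ i j → entry H i j ≡ entry G i j + ε x y i j) →
                  ∀ i → valency H i ≡ valency G i + (δ x i + δ y i)
valency-addEdge {n} G H x y x<n y<n H≡G+xy i =
  trans (∑-cong n (λ j _ → H≡G+xy i j))
        (trans (∑-distrib-+ n (entry G i) (ε x y i)) (cong (valency G i +_) (∑-ε n x y i x<n y<n)))

-- The row of t sums to less than n - 1, the sum of `1 ∸ δ t j`, so it falls short at some j. This j
-- is not t, where the comparison row is already 0.
non-neighbour : ∀ {n} (G : Adjacency n) t → t < n → suc (valency G t) < n →
                ∃ λ m → m < n × t ≢ m × entry G t m ≡ 0
non-neighbour {n} G t t<n not-full = extract (∑-<⇒∃ n (entry G t) (λ j → 1 ∸ δ t j) (+-cancelʳ-< 1 _ _ (begin-strict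
    valency G t + 1                         ≡⟨ +-comm _ 1 ⟩
    suc (valency G t)                       <⟨ not-full ⟩
    n                                       ≡⟨ *-identityʳ n ⟨
    n * 1                                   ≡⟨ ∑-const n 1 ⟨
    ∑ n (λ _ → 1)                           ≡⟨ ∑-cong n (λ j _ → sym (m∸n+n≡m (δ≤1 t j))) ⟩
    ∑ n (λ j → 1 ∸ δ t j + δ t j)           ≡⟨ ∑-distrib-+ n _ _ ⟩
    ∑ n (λ j → 1 ∸ δ t j) + ∑ n (δ t)       ≡⟨ cong (∑ n (λ j → 1 ∸ δ t j) +_) (∑-δ n t t<n) ⟩
    ∑ n (λ j → 1 ∸ δ t j) + 1               ∎)))
  where
  open ≤-Reasoning
  extract : (∃ λ m → m < n × entry G t m < 1 ∸ δ t m) → ∃ λ m → m < n × t ≢ m × entry G t m ≡ 0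
  extract (m , m<n , lt) = m , m<n
    , (λ { refl → n≮0 (subst (λ z → entry G t t < 1 ∸ z) (δ-refl t) lt) })
    , n<1⇒n≡0 (<-≤-trans lt (m∸n≤m 1 (δ t m)))

private-neighbour : ∀ {n} (G : Adjacency n) l m → l < n → m < n → m ≢ l → valency G l < valency G m →
                    ∃ λ k → k < n × l ≢ k × m ≢ k × entry G l k < entry G m k
private-neighbour {n} G l m l<n m<n m≢l l<m = extract (∑-<⇒∃ n _ _ (begin-strict
    ∑ n (λ k → entry G l k + w * δ l k)   ≡⟨ with-loop l l<n ⟩
    valency G l + w                       <⟨ +-monoˡ-< w l<m ⟩
    valency G m + w                       ≡⟨ with-loop m m<n ⟨
    ∑ n (λ k → entry G m k + w * δ m k)   ∎))
  where
  open ≤-Reasoning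
  -- Loops of weight w at l and m cancel the contributions of l and m to each other's valency.
  w = entry G l m
  with-loop : ∀ v → v < n → ∑ n (λ k → entry G v k + w * δ v k) ≡ valency G v + w
  with-loop v v<n = trans (∑-distrib-+ n _ _) (cong (valency G v +_)
    (trans (∑-distribˡ-* n w (δ v)) (trans (cong (w *_) (∑-δ n v v<n)) (*-identityʳ w))))

  at-loop : ∀ v → entry G v v + w * δ v v ≡ w
  at-loop v = trans (cong₂ (λ y z → y + w * z) (loopless G v) (δ-refl v)) (*-identityʳ w)
  off-loop : ∀ v k → v ≢ k → entry G v k + w * δ v k ≡ entry G v k
  off-loop v k v≢k = trans (cong (λ z → entry G v k + w * z) (δ-≢ v k v≢k))
                           (trans (cong (entry G v k +_) (*-zeroʳ w)) (+-identityʳ _))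

  extract : (∃ λ k → k < n × entry G l k + w * δ l k < entry G m k + w * δ m k) →
            ∃ λ k → k < n × l ≢ k × m ≢ k × entry G l k < entry G m k
  extract (k , k<n , lt) = k , k<n , l≢k , m≢k , subst₂ _<_ (off-loop l k l≢k) (off-loop m k m≢k) lt
    where
    l≢k : l ≢ k
    l≢k refl = <-irrefl (trans (at-loop l) (trans (symmetric G l m) (sym (off-loop m l m≢l)))) lt
    m≢k : m ≢ k
    m≢k refl = <-irrefl (trans (off-loop l m (m≢l ∘ sym)) (sym (at-loop m))) lt

exchange : ∀ {n} (G : Adjacency n) t l m k → t < n → l < n → m < n → k < n →
           t ≢ l → t ≢ m → m ≢ l → l ≢ k → m ≢ k → entry G t m ≡ 0 → entry G l k < entry G m k →
           Σ (Adjacency n) λ H → ∀ i → valency H i ≡ valency G i + (δ t i + δ l i)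
exchange {n} G t l m k t<n l<n m<n k<n t≢l t≢m m≢l l≢k m≢k tm≡0 lk<mk
  with addEdge G t m t<n m<n t≢m tm≡0
... | H₁ , add₁
  with addEdge H₁ l k l<n k<n l≢k
         (trans (add₁ l k) (cong₂ _+_ (n<1⇒n≡0 (<-≤-trans lk<mk (entry≤1 G m k))) (ε-outside t m l k t≢l m≢l)))
... | H₂ , add₂
  with removeEdge H₂ m k m≢k (subst (1 ≤_) (sym (trans (add₂ m k) (cong (_+ ε l k m k) (add₁ m k))))
         (≤-trans (≤-trans (s≤s z≤n) lk<mk) (≤-trans (m≤m+n _ (ε t m m k)) (m≤m+n _ (ε l k m k)))))
... | H₃ , remove = H₃ , valency-H₃
  where
  regroup : ∀ v t m l k → v + (t + m) + (l + k) ≡ v + (t + l) + (m + k)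
  regroup = solve-∀
  open ≡-Reasoning
  valency-H₃ : ∀ i → valency H₃ i ≡ valency G i + (δ t i + δ l i)
  -- The vertices m and k each gain one edge and lose one; the edge mk is restored on both sides so
  -- that only additions are compared.
  valency-H₃ i = +-cancelʳ-≡ (δ m i + δ k i) _ _ (begin
    valency H₃ i + (δ m i + δ k i)                     ≡⟨ valency-addEdge H₃ H₂ m k m<n k<n (λ i j → sym (remove i j)) i ⟨
    valency H₂ i                                       ≡⟨ valency-addEdge H₁ H₂ l k l<n k<n add₂ i ⟩
    valency H₁ i + (δ l i + δ k i)                     ≡⟨ cong (_+ (δ l i + δ k i)) (valency-addEdge G H₁ t m t<n m<n add₁ i) ⟩
    valency G i + (δ t i + δ m i) + (δ l i + δ k i)    ≡⟨ regroup (valency G i) (δ t i) (δ m i) (δ l i) (δ k i) ⟩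
    valency G i + (δ t i + δ l i) + (δ m i + δ k i)    ∎)

-- If tl is already an edge, some m is not adjacent to t, and m has a neighbour k not adjacent to l
-- because m has the larger valency; the edge mk is then replaced by tm and lk.
raise-valencies : ∀ {n} (G : Adjacency n) t l → t < n → l < n → t ≢ l → suc (valency G t) < n →
                  (∀ m → m < n → m ≢ t → m ≢ l → valency G l < valency G m) →
                  Σ (Adjacency n) λ H → ∀ i → valency H i ≡ valency G i + (δ t i + δ l i)
raise-valencies {n} G t l t<n l<n t≢l not-full l-min with entry G t l ≟ 0
... | yes tl≡0 with addEdge G t l t<n l<n t≢l tl≡0
...   | H , add = H , valency-addEdge G H t l t<n l<n add
raise-valencies {n} G t l t<n l<n t≢l not-full l-min | no tl≢0
  with non-neighbour G t t<n not-full
... | m , m<n , t≢m , tm≡0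
  with private-neighbour G l m l<n m<n m≢l (l-min m m<n (t≢m ∘ sym) m≢l)
  where
  m≢l : m ≢ l
  m≢l refl = tl≢0 tm≡0
... | k , k<n , l≢k , m≢k , lk<mk =
  exchange G t l m k t<n l<n m<n k<n t≢l t≢m (λ { refl → tl≢0 tm≡0 }) l≢k m≢k tm≡0 lk<mk

-- Sufficiency of the Erdős–Gallai inequalities

even-even+ : ∀ m n → evenᵇ m ≡ true → evenᵇ (m + n) ≡ evenᵇ n
even-even+ zero          n e = refl
even-even+ (suc (suc m)) n e = even-even+ m n e

even-odd+ : ∀ m n → evenᵇ m ≡ false → evenᵇ (m + n) ≡ not (evenᵇ n)
even-odd+ (suc zero)    zero          e = refl
even-odd+ (suc zero)    (suc zero)    e = refl
even-odd+ (suc zero)    (suc (suc n)) e = even-odd+ 1 n e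
even-odd+ (suc (suc m)) n             e = even-odd+ m n e

even-n+n : ∀ n → evenᵇ (n + n) ≡ true
even-n+n zero    = refl
even-n+n (suc n) = trans (cong (evenᵇ ∘ suc) (+-suc n n)) (even-n+n n)

even-n*n+n : ∀ n → evenᵇ (n * n + n) ≡ true
even-n*n+n zero    = refl
even-n*n+n (suc n) = trans (cong evenᵇ (expand n)) (trans (even-even+ (suc n + suc n) _ (even-n+n (suc n))) (even-n*n+n n))
  where
  expand : ∀ n → suc n * suc n + suc n ≡ (suc n + suc n) + (n * n + n)
  expand = solve-∀

NonIncreasing : ℕ → (ℕ → ℕ) → Set
NonIncreasing n a = ∀ i j → i ≤ j → j < n → a j ≤ a i

-- Naming the tail length m through `k + m ≡ n` avoids truncated subtraction; indices start at 0, so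
-- the tail begins at `a k`.
ErdősGallai : ℕ → (ℕ → ℕ) → Set
ErdősGallai n a = ∀ k m → k + m ≡ n → ∑ k a ≤ k * (k ∸ 1) + ∑ m (λ j → k ⊓ a (k + j))

-- The search stops at l - 1 at the latest, so that t differs from l even for a constant sequence;
-- otherwise the run ends in a strict drop.
first-run : ∀ l a → 0 < l → NonIncreasing (suc l) a →
            ∃ λ t → t < l × (∀ i → i ≤ t → a i ≡ a 0) × (suc t ≡ l ⊎ a (suc t) < a t)
first-run l a 0<l mono = search (pred l) 0 (suc-pred l ⦃ >-nonZero 0<l ⦄) λ { zero z≤n → refl }
  where
  search : ∀ fuel t → suc t + fuel ≡ l → (∀ i → i ≤ t → a i ≡ a 0) →
           ∃ λ t → t < l × (∀ i → i ≤ t → a i ≡ a 0) × (suc t ≡ l ⊎ a (suc t) < a t)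
  search zero       t eq run = t , ≤-reflexive eq′ , run , inj₁ eq′
    where eq′ = trans (sym (+-identityʳ (suc t))) eq
  search (suc fuel) t eq run with a (suc t) <? a t
  ... | yes lt = t , t<l , run , inj₂ lt
    where t<l = subst (t <_) eq (m≤m+n (suc t) (suc fuel))
  ... | no ¬lt = search fuel (suc t) (trans (sym (+-suc (suc t) fuel)) eq) run′
    where
    t<l = subst (t <_) eq (m≤m+n (suc t) (suc fuel))
    run′ : ∀ i → i ≤ suc t → a i ≡ a 0
    run′ i i≤st with m≤n⇒m<n∨m≡n i≤st
    ... | inj₁ i<st = run i (s≤s⁻¹ i<st)
    ... | inj₂ refl = trans (≤-antisym (mono t (suc t) (n≤1+n t) (s≤s t<l)) (≮⇒≥ ¬lt)) (run t ≤-refl)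

k*[k∸1]+k≡k*k : ∀ k → k * (k ∸ 1) + k ≡ k * k
k*[k∸1]+k≡k*k zero    = refl
k*[k∸1]+k≡k*k (suc k) = lemma k
  where
  lemma : ∀ k → suc k * k + suc k ≡ suc k * suc k
  lemma = solve-∀

⊓-lower : ∀ k x y d → x ≤ y + d → k ⊓ x ≤ k ⊓ y + d
⊓-lower k x y d x≤y+d with ≤-total k y
... | inj₁ k≤y = ≤-trans (m⊓n≤m k x) (subst (k ≤_) (cong (_+ d) (sym (m≤n⇒m⊓n≡m k≤y))) (m≤m+n k d))
... | inj₂ y≤k = ≤-trans (m⊓n≤n k x) (subst (x ≤_) (cong (_+ d) (sym (m≥n⇒m⊓n≡n y≤k))) x≤y+d)

-- The quotient of `k ⊓ x` by k does not increase with k; denominators are cleared.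
scale-⊓ : ∀ k x → k * (suc k ⊓ x) ≤ suc k * (k ⊓ x)
scale-⊓ k x with x ≤? k
... | yes x≤k rewrite m≥n⇒m⊓n≡n x≤k | m≥n⇒m⊓n≡n (m≤n⇒m≤1+n x≤k) = *-monoˡ-≤ x (n≤1+n k)
... | no x≰k rewrite m≤n⇒m⊓n≡m (<⇒≤ (≰⇒> x≰k)) | m≤n⇒m⊓n≡m (≰⇒> x≰k) = ≤-reflexive (*-comm k (suc k))

-- Choudum's lowering step preserves the inequalities

module ChoudumStep (l : ℕ) (a : ℕ → ℕ) (mono : NonIncreasing (suc l) a) (eg : ErdősGallai (suc l) a)
                   (t : ℕ) (t<l : t < l) (run : ∀ i → i ≤ t → a i ≡ a 0)
                   (run-end : suc t ≡ l ⊎ a (suc t) < a t) (0<al : 0 < a l) where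

  lowered : ℕ → ℕ
  lowered i = a i ∸ (δ t i + δ l i)

  a≥1 : ∀ i → i ≤ l → 1 ≤ a i
  a≥1 i i≤l = ≤-trans 0<al (mono i l i≤l ≤-refl)

  lowered-t : lowered t ≡ a t ∸ 1
  lowered-t = cong (a t ∸_) (cong₂ _+_ (δ-refl t) (δ-≢ l t (>⇒≢ t<l)))

  lowered-l : lowered l ≡ a l ∸ 1
  lowered-l = cong (a l ∸_) (cong₂ _+_ (δ-≢ t l (<⇒≢ t<l)) (δ-refl l))

  lowered-other : ∀ i → t ≢ i → l ≢ i → lowered i ≡ a i
  lowered-other i t≢i l≢i = cong (a i ∸_) (cong₂ _+_ (δ-≢ t i t≢i) (δ-≢ l i l≢i))

  lowered≤a : ∀ i → lowered i ≤ a i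
  lowered≤a i = m∸n≤m (a i) (δ t i + δ l i)

  -- Since t and l differ, at most one unit leaves each term, and every term up to l is at least
  -- `a l`, which is positive. The truncated subtraction in `lowered` is thus exact.
  δδ≤a : ∀ i → δ t i + δ l i ≤ a i
  δδ≤a i with t ≟ i | l ≟ i
  ... | yes refl | _ rewrite δ-refl t | δ-≢ l t (>⇒≢ t<l) = a≥1 t (<⇒≤ t<l)
  ... | no t≢i | yes refl rewrite δ-refl l | δ-≢ t l t≢i = 0<al
  ... | no t≢i | no l≢i rewrite δ-≢ t i t≢i | δ-≢ l i l≢i = z≤n

  lowered+δδ : ∀ i → lowered i + (δ t i + δ l i) ≡ a i
  lowered+δδ i = m∸n+n≡m (δδ≤a i)

  ∑-lowered : ∀ n → ∑ n lowered + (∑ n (δ t) + ∑ n (δ l)) ≡ ∑ n a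
  ∑-lowered n = trans (cong (∑ n lowered +_) (sym (∑-distrib-+ n (δ t) (δ l))))
    (trans (sym (∑-distrib-+ n lowered _)) (∑-cong n λ i _ → lowered+δδ i))

  ∑-lowered-all : 2 + ∑ (suc l) lowered ≡ ∑ (suc l) a
  ∑-lowered-all = trans (+-comm 2 (∑ (suc l) lowered)) (trans
    (cong (∑ (suc l) lowered +_) (sym (cong₂ _+_ (∑-δ (suc l) t (m<n⇒m<1+n t<l)) (∑-δ (suc l) l ≤-refl))))
    (∑-lowered (suc l)))

  -- The order can break only just after t. Either the next term is strictly smaller than `a t`, or
  -- it is the term at l, which is lowered as well.
  lowered-mono : NonIncreasing (suc l) lowered
  lowered-mono i j i≤j j<sl with t ≟ i | l ≟ i
  ... | no t≢i | no l≢i =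
    ≤-trans (lowered≤a j) (≤-trans (mono i j i≤j j<sl) (≤-reflexive (sym (lowered-other i t≢i l≢i))))
  ... | no t≢i | yes refl rewrite ≤-antisym (s≤s⁻¹ j<sl) i≤j = ≤-refl
  ... | yes refl | _ with m≤n⇒m<n∨m≡n i≤j | l ≟ j
  ...   | inj₂ refl | _ = ≤-refl
  ...   | inj₁ t<j | yes refl rewrite lowered-t | lowered-l = ∸-monoˡ-≤ 1 (mono t l i≤j j<sl)
  ...   | inj₁ t<j | no l≢j = [ last , drops ]′ run-end
    where
    last : suc t ≡ l → lowered j ≤ lowered t
    last st≡l = contradiction (≤-antisym (subst (_≤ j) st≡l t<j) (s≤s⁻¹ j<sl)) l≢j
    drops : a (suc t) < a t → lowered j ≤ lowered t
    drops lt = subst (lowered j ≤_) (sym lowered-t)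
      (≤-trans (lowered≤a j) (≤-trans (mono (suc t) j t<j j<sl) (∸-monoˡ-≤ 1 lt)))

  tail : (ℕ → ℕ) → ℕ → ℕ → ℕ
  tail b k m = ∑ m (λ j → k ⊓ b (k + j))

  ∑δ-split : ∀ k m → k + m ≡ suc l → ∀ x → x < suc l → ∑ k (δ x) + ∑ m (λ j → δ x (k + j)) ≡ 1
  ∑δ-split k m k+m≡n x x<n =
    trans (sym (∑-split k m (δ x))) (trans (cong (λ n → ∑ n (δ x)) k+m≡n) (∑-δ (suc l) x x<n))

  k+j<n : ∀ k m j → k + m ≡ suc l → j < m → k + j < suc l
  k+j<n k m j k+m≡n j<m = subst (k + j <_) k+m≡n (+-monoʳ-< k j<m)

  tail≤tail+δ : ∀ k m (b : ℕ → ℕ) → (∀ j → j < m → k ⊓ a (k + j) ≤ k ⊓ lowered (k + j) + b (k + j)) →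
                tail a k m ≤ tail lowered k m + ∑ m (λ j → b (k + j))
  tail≤tail+δ k m b h = ≤-trans (∑-mono-≤ m h) (≤-reflexive (∑-distrib-+ m _ _))

  -- The head contains t and loses at least one unit; the tail can lose only the unit at l.
  after-run : ∀ k m → k + m ≡ suc l → t < k → ∑ k lowered ≤ k * (k ∸ 1) + tail lowered k m
  after-run k m k+m≡n t<k = +-cancelʳ-≤ 1 _ _ (begin
    ∑ k lowered + 1                                                    ≤⟨ +-monoʳ-≤ (∑ k lowered) (m≤m+n 1 (∑ k (δ l))) ⟩
    ∑ k lowered + (1 + ∑ k (δ l))                                      ≡⟨ cong (λ z → ∑ k lowered + (z + ∑ k (δ l))) (∑-δ k t t<k) ⟨
    ∑ k lowered + (∑ k (δ t) + ∑ k (δ l))                              ≡⟨ ∑-lowered k ⟩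
    ∑ k a                                                              ≤⟨ eg k m k+m≡n ⟩
    k * (k ∸ 1) + tail a k m                                           ≤⟨ +-monoʳ-≤ (k * (k ∸ 1)) (tail≤tail+δ k m (λ i → δ t i + δ l i) (λ j _ → ⊓-lower k (a (k + j)) (lowered (k + j)) _ (≤-reflexive (sym (lowered+δδ (k + j)))))) ⟩
    k * (k ∸ 1) + (tail lowered k m + ∑ m (λ j → δ t (k + j) + δ l (k + j)))
                                                                       ≤⟨ +-monoʳ-≤ (k * (k ∸ 1)) (+-monoʳ-≤ (tail lowered k m) tails) ⟩
    k * (k ∸ 1) + (tail lowered k m + 1)                               ≡⟨ +-assoc (k * (k ∸ 1)) _ 1 ⟨
    k * (k ∸ 1) + tail lowered k m + 1                                 ∎)
    where
    open ≤-Reasoning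
    t-tail : ∑ m (λ j → δ t (k + j)) ≡ 0
    t-tail = +-cancelˡ-≡ 1 _ _ (trans (cong (_+ ∑ m (λ j → δ t (k + j))) (sym (∑-δ k t t<k)))
                                      (∑δ-split k m k+m≡n t (m<n⇒m<1+n t<l)))
    tails : ∑ m (λ j → δ t (k + j) + δ l (k + j)) ≤ 1
    tails = begin
      ∑ m (λ j → δ t (k + j) + δ l (k + j))                  ≡⟨ ∑-distrib-+ m _ _ ⟩
      ∑ m (λ j → δ t (k + j)) + ∑ m (λ j → δ l (k + j))      ≡⟨ cong (_+ ∑ m (λ j → δ l (k + j))) t-tail ⟩
      ∑ m (λ j → δ l (k + j))                                ≤⟨ m≤n+m _ (∑ k (δ l)) ⟩
      ∑ k (δ l) + ∑ m (λ j → δ l (k + j))                    ≡⟨ ∑δ-split k m k+m≡n l ≤-refl ⟩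
      1                                                      ∎

  -- Here the head consists of k unchanged terms equal to `a 0`, and both lowered terms lie in the
  -- tail. The possible loss of two units is treated according to the position of k relative to
  -- `a 0` and `a l`.
  module InRun (k m : ℕ) (k+sm≡n : k + suc m ≡ suc l) (k≤t : k ≤ t) where

    open ≤-Reasoning

    k<l : k < l
    k<l = ≤-<-trans k≤t t<l

    0<m : 0 < m
    0<m = +-cancelˡ-< k 0 m (subst₂ _<_ (sym (+-identityʳ k)) (sym (suc-injective (trans (sym (+-suc k m)) k+sm≡n))) k<l)

    ∑a : ∑ k a ≡ k * a 0
    ∑a = trans (∑-cong k λ i i<k → run i (≤-trans (<⇒≤ i<k) k≤t)) (∑-const k (a 0))

    ∑lowered : ∑ k lowered ≡ k * a 0
    ∑lowered = trans (∑-cong k λ i i<k → lowered-other i (>⇒≢ (<-≤-trans i<k k≤t)) (>⇒≢ (<-trans i<k k<l))) ∑a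

    a[k+0] : a (k + 0) ≡ a 0
    a[k+0] = trans (cong a (+-identityʳ k)) (run k k≤t)

    small : a 0 < k → ∑ k lowered ≤ k * (k ∸ 1) + tail lowered k (suc m)
    small a0<k = begin
      ∑ k lowered                               ≡⟨ ∑lowered ⟩
      k * a 0                                   ≤⟨ *-monoʳ-≤ k (∸-monoˡ-≤ 1 a0<k) ⟩
      k * (k ∸ 1)                               ≤⟨ m≤m+n _ _ ⟩
      k * (k ∸ 1) + tail lowered k (suc m)      ∎

    -- The total exceeds k * k + k, which is even, so by parity it does so by at least 2.
    critical : a 0 ≡ k → evenᵇ (∑ (suc l) a) ≡ true → ∑ k lowered ≤ k * (k ∸ 1) + tail lowered k (suc m)
    critical a0≡k even = begin
      ∑ k lowered                                    ≡⟨ trans ∑lowered (cong (k *_) a0≡k) ⟩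
      k * k                                          ≡⟨ k*[k∸1]+k≡k*k k ⟨
      k * (k ∸ 1) + k                                ≤⟨ +-monoʳ-≤ (k * (k ∸ 1)) k≤tail ⟩
      k * (k ∸ 1) + tail lowered k (suc m)           ∎
      where
      -- As `k ≤ t`, the terms at indices 0 to k all equal k, and `0<m` leaves at least one further
      -- positive term.
      total≥ : suc (k * k + k) ≤ ∑ (suc l) a
      total≥ = begin
        suc (k * k + k)                                          ≡⟨ +-comm 1 _ ⟩
        k * k + k + 1                                            ≡⟨ +-assoc (k * k) k 1 ⟩
        k * k + (k + 1)                                          ≤⟨ +-monoʳ-≤ (k * k) (+-mono-≤ (≤-reflexive (sym (trans a[k+0] a0≡k))) rest≥1) ⟩
        k * k + ∑ (suc m) (λ j → a (k + j))                      ≡⟨ cong (_+ ∑ (suc m) (λ j → a (k + j))) (trans ∑a (cong (k *_) a0≡k)) ⟨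
        ∑ k a + ∑ (suc m) (λ j → a (k + j))                      ≡⟨ ∑-split k (suc m) a ⟨
        ∑ (k + suc m) a                                          ≡⟨ cong (λ n → ∑ n a) k+sm≡n ⟩
        ∑ (suc l) a                                              ∎
        where
        rest≥1 : 1 ≤ ∑ m (λ j → a (k + suc j))
        rest≥1 = begin
          1                            ≤⟨ 0<m ⟩
          m                            ≡⟨ *-identityʳ m ⟨
          m * 1                        ≡⟨ ∑-const m 1 ⟨
          ∑ m (λ _ → 1)                ≤⟨ ∑-mono-≤ m (λ j j<m → a≥1 (k + suc j) (s≤s⁻¹ (k+j<n k (suc m) (suc j) k+sm≡n (s<s j<m)))) ⟩
          ∑ m (λ j → a (k + suc j))    ∎
      total≢ : suc (k * k + k) ≢ ∑ (suc l) a
      total≢ eq with trans (sym (trans (sym (cong evenᵇ eq)) (trans (cong evenᵇ (+-comm 1 (k * k + k))) (even-even+ (k * k + k) 1 (even-n*n+n k))))) even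
      ... | ()
      lowered-tail : tail lowered k (suc m) ≡ ∑ (suc m) (λ j → lowered (k + j))
      lowered-tail = ∑-cong (suc m) λ j j<sm → m≥n⇒m⊓n≡n
        (≤-trans (lowered≤a (k + j)) (≤-trans (mono 0 (k + j) z≤n (k+j<n k (suc m) j k+sm≡n j<sm)) (≤-reflexive a0≡k)))
      k≤tail : k ≤ tail lowered k (suc m)
      k≤tail = +-cancelˡ-≤ (k * k) _ _ (+-cancelˡ-≤ 2 _ _ (begin
        2 + (k * k + k)                                             ≤⟨ ≤∧≢⇒< total≥ total≢ ⟩
        ∑ (suc l) a                                                 ≡⟨ ∑-lowered-all ⟨
        2 + ∑ (suc l) lowered                                       ≡⟨ cong (λ n → 2 + ∑ n lowered) k+sm≡n ⟨
        2 + ∑ (k + suc m) lowered                                   ≡⟨ cong (2 +_) (∑-split k (suc m) lowered) ⟩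
        2 + (∑ k lowered + ∑ (suc m) (λ j → lowered (k + j)))       ≡⟨ cong₂ (λ y z → 2 + (y + z)) (trans ∑lowered (cong (k *_) a0≡k)) (sym lowered-tail) ⟩
        2 + (k * k + tail lowered k (suc m))                        ∎))

    -- Even the smallest lowered term, `a l ∸ 1`, is still at least k, so no minimum in the tail
    -- changes.
    large-end : k < a l → ∑ k lowered ≤ k * (k ∸ 1) + tail lowered k (suc m)
    large-end k<al = begin
      ∑ k lowered                             ≡⟨ trans ∑lowered (sym ∑a) ⟩
      ∑ k a                                   ≤⟨ eg k (suc m) k+sm≡n ⟩
      k * (k ∸ 1) + tail a k (suc m)          ≤⟨ +-monoʳ-≤ (k * (k ∸ 1)) (∑-mono-≤ (suc m) λ j j<sm → ≤-trans (m⊓n≤m k (a (k + j))) (≤-reflexive (sym (m≤n⇒m⊓n≡m (k≤lowered j j<sm))))) ⟩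
      k * (k ∸ 1) + tail lowered k (suc m)    ∎
      where
      k≤lowered : ∀ j → j < suc m → k ≤ lowered (k + j)
      k≤lowered j j<sm = ≤-trans (subst (k ≤_) (sym lowered-l) (∸-monoˡ-≤ 1 k<al))
        (lowered-mono (k + j) l (s≤s⁻¹ (k+j<n k (suc m) j k+sm≡n j<sm)) ≤-refl)

    -- Equality at k would contradict the inequality at k + 1.
    eg-strict : k < a 0 → a l ≤ k → ∑ k a < k * (k ∸ 1) + tail a k (suc m)
    -- The inequality at k + 1 is multiplied by k and the one at k by k + 1. As the terms up to
    -- index k all equal `a 0`, both left sides become k (k + 1) `a 0`, and only the tails remain to
    -- be compared.
    eg-strict k<a0 al≤k = ≰⇒> λ tight → <-irrefl refl (begin-strict
      k * (suc k * a 0)                                ≡⟨ cong (k *_) ∑sa ⟨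
      k * ∑ (suc k) a                                  ≤⟨ *-monoʳ-≤ k (eg (suc k) m (trans (sym (+-suc k m)) k+sm≡n)) ⟩
      k * (suc k * k + tail a (suc k) m)               ≡⟨ *-distribˡ-+ k (suc k * k) _ ⟩
      k * (suc k * k) + k * tail a (suc k) m           <⟨ +-monoʳ-< (k * (suc k * k)) tails ⟩
      k * (suc k * k) + suc k * R                      ≡⟨ regroup k R ⟩
      suc k * (k * k + R)                              ≡⟨ cong (λ z → suc k * (z + R)) (k*[k∸1]+k≡k*k k) ⟨
      suc k * (k * (k ∸ 1) + k + R)                    ≡⟨ cong (suc k *_) (+-assoc (k * (k ∸ 1)) k R) ⟩
      suc k * (k * (k ∸ 1) + (k + R))                  ≡⟨ cong (λ z → suc k * (k * (k ∸ 1) + (z + R))) (m≤n⇒m⊓n≡m (≤-trans (<⇒≤ k<a0) (≤-reflexive (sym a[k+0])))) ⟨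
      suc k * (k * (k ∸ 1) + tail a k (suc m))         ≤⟨ *-monoʳ-≤ (suc k) tight ⟩
      suc k * ∑ k a                                    ≡⟨ cong (suc k *_) ∑a ⟩
      suc k * (k * a 0)                                ≡⟨ rotate k (a 0) ⟩
      k * (suc k * a 0)                                ∎)
      where
      R = ∑ m (λ j → k ⊓ a (k + suc j))
      rotate : ∀ k x → suc k * (k * x) ≡ k * (suc k * x)
      rotate = solve-∀
      regroup : ∀ k r → k * (suc k * k) + suc k * r ≡ suc k * (k * k + r)
      regroup = solve-∀
      ∑sa : ∑ (suc k) a ≡ suc k * a 0
      ∑sa = trans (∑-cong (suc k) λ i i<sk → run i (≤-trans (s≤s⁻¹ i<sk) k≤t)) (∑-const (suc k) (a 0))
      -- The strictness comes from l: there both minima equal `a l`, and (k + 1) `a l` exceeds k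
      -- `a l` by `a l`, which is at least 1.
      pointwise : ∀ i → k * (suc k ⊓ a i) + δ l i ≤ suc k * (k ⊓ a i)
      pointwise i with l ≟ i
      ... | no l≢i rewrite δ-≢ l i l≢i | +-identityʳ (k * (suc k ⊓ a i)) = scale-⊓ k (a i)
      ... | yes refl rewrite δ-refl l | m≥n⇒m⊓n≡n al≤k | m≥n⇒m⊓n≡n (m≤n⇒m≤1+n al≤k) =
        ≤-trans (+-monoʳ-≤ (k * a l) 0<al) (≤-reflexive (+-comm (k * a l) (a l)))
      δ-tail : ∑ m (λ j → δ l (suc k + j)) ≡ 1
      δ-tail = trans (cong (_+ ∑ m (λ j → δ l (suc k + j))) (sym (∑-δ-outside (suc k) l k<l)))
                     (∑δ-split (suc k) m (trans (sym (+-suc k m)) k+sm≡n) l ≤-refl)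
      tails : k * tail a (suc k) m < suc k * R
      tails = begin
        suc (k * tail a (suc k) m)                                          ≡⟨ +-comm 1 _ ⟩
        k * tail a (suc k) m + 1                                            ≡⟨ cong₂ _+_ (∑-distribˡ-* m k _) δ-tail ⟨
        ∑ m (λ j → k * (suc k ⊓ a (suc k + j))) + ∑ m (λ j → δ l (suc k + j)) ≡⟨ ∑-distrib-+ m _ _ ⟨
        ∑ m (λ j → k * (suc k ⊓ a (suc k + j)) + δ l (suc k + j))           ≤⟨ ∑-mono-≤ m (λ j _ → pointwise (suc k + j)) ⟩
        ∑ m (λ j → suc k * (k ⊓ a (suc k + j)))                             ≡⟨ ∑-distribˡ-* m (suc k) _ ⟩
        suc k * ∑ m (λ j → k ⊓ a (suc k + j))                               ≡⟨ cong (suc k *_) (∑-cong m λ j _ → cong (λ i → k ⊓ a i) (sym (+-suc k j))) ⟩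
        suc k * R                                                           ∎

    -- Lowering at t does not affect the minimum with k, since `a 0 ∸ 1` is at least k. Only the
    -- unit at l can be lost, and `eg-strict` pays for it.
    large-start : k < a 0 → a l ≤ k → ∑ k lowered ≤ k * (k ∸ 1) + tail lowered k (suc m)
    large-start k<a0 al≤k = +-cancelʳ-≤ 1 _ _ (begin
      ∑ k lowered + 1                                                          ≡⟨ cong (_+ 1) (trans ∑lowered (sym ∑a)) ⟩
      ∑ k a + 1                                                                ≡⟨ +-comm _ 1 ⟩
      suc (∑ k a)                                                              ≤⟨ eg-strict k<a0 al≤k ⟩
      k * (k ∸ 1) + tail a k (suc m)                                           ≤⟨ +-monoʳ-≤ (k * (k ∸ 1)) (tail≤tail+δ k (suc m) (δ l) (λ j _ → pointwise (k + j))) ⟩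
      k * (k ∸ 1) + (tail lowered k (suc m) + ∑ (suc m) (λ j → δ l (k + j)))   ≤⟨ +-monoʳ-≤ (k * (k ∸ 1)) (+-monoʳ-≤ (tail lowered k (suc m)) (≤-trans (m≤n+m _ (∑ k (δ l))) (≤-reflexive (∑δ-split k (suc m) k+sm≡n l ≤-refl)))) ⟩
      k * (k ∸ 1) + (tail lowered k (suc m) + 1)                               ≡⟨ +-assoc (k * (k ∸ 1)) _ 1 ⟨
      k * (k ∸ 1) + tail lowered k (suc m) + 1                                 ∎)
      where
      pointwise : ∀ i → k ⊓ a i ≤ k ⊓ lowered i + δ l i
      pointwise i with t ≟ i
      ... | no t≢i = ⊓-lower k _ _ _ (≤-reflexive (trans (sym (lowered+δδ i)) (cong (λ z → lowered i + (z + δ l i)) (δ-≢ t i t≢i))))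
      ... | yes refl = ≤-trans (m⊓n≤m k (a t)) (≤-trans (≤-reflexive (sym (m≤n⇒m⊓n≡m k≤))) (m≤m+n _ (δ l t)))
        where
        k≤ : k ≤ lowered t
        k≤ = subst (k ≤_) (sym lowered-t) (∸-monoˡ-≤ 1 (subst (k <_) (sym (run t ≤-refl)) k<a0))

    conclusion : evenᵇ (∑ (suc l) a) ≡ true → ∑ k lowered ≤ k * (k ∸ 1) + tail lowered k (suc m)
    conclusion even with <-cmp (a 0) k | k <? a l
    ... | tri< a0<k _ _ | _        = small a0<k
    ... | tri≈ _ a0≡k _ | _        = critical a0≡k even
    ... | tri> _ _ k<a0 | yes k<al = large-end k<al
    ... | tri> _ _ k<a0 | no k≮al  = large-start k<a0 (≮⇒≥ k≮al)

  lowered-eg : evenᵇ (∑ (suc l) a) ≡ true → ErdősGallai (suc l) lowered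
  lowered-eg even k m k+m≡n with t <? k
  ... | yes t<k = after-run k m k+m≡n t<k
  lowered-eg even k zero    k+m≡n | no t≮k =
    contradiction (subst (t <_) (sym (trans (sym (+-identityʳ k)) k+m≡n)) (m<n⇒m<1+n t<l)) t≮k
  lowered-eg even k (suc m) k+m≡n | no t≮k = InRun.conclusion k m k+m≡n (≮⇒≥ t≮k) even

-- The induction

first≤n-1 : ∀ l a → ∑ 1 a ≤ ∑ l (λ j → 1 ⊓ a (1 + j)) → a 0 ≤ l
first≤n-1 l a eg₁ = begin
  a 0                             ≡⟨ +-identityʳ (a 0) ⟨
  a 0 + 0                         ≤⟨ eg₁ ⟩
  ∑ l (λ j → 1 ⊓ a (1 + j))       ≤⟨ ∑-mono-≤ l (λ j _ → m⊓n≤m 1 _) ⟩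
  ∑ l (λ _ → 1)                   ≡⟨ ∑-const l 1 ⟩
  l * 1                           ≡⟨ *-identityʳ l ⟩
  l                               ∎
  where open ≤-Reasoning

eg-init : ∀ l a → a l ≡ 0 → ErdősGallai (suc l) a → ErdősGallai l a
eg-init l a al≡0 eg k m k+m≡l = begin
  ∑ k a                                                  ≤⟨ eg k (suc m) (trans (+-suc k m) (cong suc k+m≡l)) ⟩
  k * (k ∸ 1) + ∑ (suc m) (λ j → k ⊓ a (k + j))          ≡⟨ cong (k * (k ∸ 1) +_) (∑-snoc m _) ⟩
  k * (k ∸ 1) + (∑ m (λ j → k ⊓ a (k + j)) + k ⊓ a (k + m))
                                                         ≡⟨ cong (λ z → k * (k ∸ 1) + (∑ m (λ j → k ⊓ a (k + j)) + k ⊓ z)) (trans (cong a k+m≡l) al≡0) ⟩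
  k * (k ∸ 1) + (∑ m (λ j → k ⊓ a (k + j)) + k ⊓ 0)      ≡⟨ cong (λ z → k * (k ∸ 1) + (∑ m (λ j → k ⊓ a (k + j)) + z)) (⊓-zeroʳ k) ⟩
  k * (k ∸ 1) + (∑ m (λ j → k ⊓ a (k + j)) + 0)          ≡⟨ cong (k * (k ∸ 1) +_) (+-identityʳ _) ⟩
  k * (k ∸ 1) + ∑ m (λ j → k ⊓ a (k + j))                ∎
  where open ≤-Reasoning

add-isolated : ∀ l a → a l ≡ 0 → Realised l a → Realised (suc l) a
add-isolated l a al≡0 (G , val) = H , val′
  where
  H : Adjacency (suc l)
  entry     H = entry G
  entry≤1   H = entry≤1 G
  symmetric H = symmetric G
  loopless  H = loopless G
  bounded   H i j sl≤j = bounded G i j (<⇒≤ sl≤j)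
  val′ : ∀ i → i < suc l → ∑ (suc l) (entry G i) ≡ a i
  val′ i i<sl with m≤n⇒m<n∨m≡n (s≤s⁻¹ i<sl)
  ... | inj₁ i<l = trans (∑-snoc l (entry G i)) (trans (cong₂ _+_ (val i i<l) (bounded G i l ≤-refl)) (+-identityʳ (a i)))
  ... | inj₂ refl = trans (∑-cong (suc l) λ j _ → trans (symmetric G l j) (bounded G j l ≤-refl))
                          (trans (∑-const (suc l) 0) (trans (*-zeroʳ (suc l)) (sym al≡0)))

-- Choudum's induction: lower by one the last term of the initial constant run and the last term of the sequence.
erdős-gallai : ∀ n a → NonIncreasing n a → evenᵇ (∑ n a) ≡ true → ErdősGallai n a → Realised n a
erdős-gallai n a = go (n + ∑ n a) n a ≤-refl
  where
  -- The measure `n + ∑ n a` drops by one when a zero last term is removed and by two when two terms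
  -- are lowered.
  go : ∀ fuel n a → n + ∑ n a ≤ fuel → NonIncreasing n a → evenᵇ (∑ n a) ≡ true → ErdősGallai n a → Realised n a
  go fuel zero a _ _ _ _ = empty , λ _ ()
    where
    empty : Adjacency 0
    entry     empty _ _ = 0
    entry≤1   empty _ _ = z≤n
    symmetric empty _ _ = refl
    loopless  empty _ = refl
    bounded   empty _ _ _ = refl
  go (suc fuel) (suc l) a size mono even eg with a l ≟ 0
  ... | yes al≡0 = add-isolated l a al≡0
    (go fuel l a (subst (λ z → l + z ≤ fuel) ∑≡ (s≤s⁻¹ size)) (λ i j i≤j j<l → mono i j i≤j (m<n⇒m<1+n j<l))
        (trans (cong evenᵇ (sym ∑≡)) even) (eg-init l a al≡0 eg))
    where
    ∑≡ : ∑ (suc l) a ≡ ∑ l a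
    ∑≡ = trans (∑-snoc l a) (trans (cong (∑ l a +_) al≡0) (+-identityʳ _))
  ... | no al≢0 with first-run l a 0<l mono
    where
    0<l : 0 < l
    0<l = ≤-trans (n≢0⇒n>0 al≢0) (≤-trans (mono 0 l z≤n ≤-refl) (first≤n-1 l a (eg 1 l refl)))
  ... | t , t<l , run , run-end with go fuel (suc l) lowered size′ lowered-mono even′ (lowered-eg even)
    where
    open ChoudumStep l a mono eg t t<l run run-end (n≢0⇒n>0 al≢0)
    even′ : evenᵇ (∑ (suc l) lowered) ≡ true
    even′ = trans (cong evenᵇ ∑-lowered-all) even
    size′ : suc l + ∑ (suc l) lowered ≤ fuel
    size′ = s≤s⁻¹ (≤-trans (≤-trans (≤-reflexive (sym (+-suc (suc l) _))) (+-monoʳ-≤ (suc l) (≤-trans (n≤1+n _) (≤-reflexive ∑-lowered-all)))) size)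
  ... | G , val with raise-valencies G t l (m<n⇒m<1+n t<l) ≤-refl (<⇒≢ t<l) not-full l-min
    where
    open ChoudumStep l a mono eg t t<l run run-end (n≢0⇒n>0 al≢0)
    suc-lowered : ∀ i → 1 ≤ a i → suc (a i ∸ 1) ≡ a i
    suc-lowered i 1≤ai = trans (+-comm 1 _) (m∸n+n≡m 1≤ai)
    not-full : suc (valency G t) < suc l
    not-full = s≤s (≤-trans (≤-reflexive (trans (cong suc (trans (val t (m<n⇒m<1+n t<l)) lowered-t)) (suc-lowered t (a≥1 t (<⇒≤ t<l)))))
                            (≤-trans (≤-reflexive (run t ≤-refl)) (first≤n-1 l a (eg 1 l refl))))
    -- The strict gap that the edge exchange needs arises because l was lowered and m was not.
    l-min : ∀ m → m < suc l → m ≢ t → m ≢ l → valency G l < valency G m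
    l-min m m<sl m≢t m≢l = begin
      suc (valency G l)     ≡⟨ cong suc (trans (val l ≤-refl) lowered-l) ⟩
      suc (a l ∸ 1)         ≡⟨ suc-lowered l (n≢0⇒n>0 al≢0) ⟩
      a l                   ≤⟨ mono m l (s≤s⁻¹ m<sl) ≤-refl ⟩
      a m                   ≡⟨ lowered-other m (m≢t ∘ sym) (m≢l ∘ sym) ⟨
      lowered m             ≡⟨ val m m<sl ⟨
      valency G m           ∎
      where open ≤-Reasoning
  ... | H , val′ = H , λ i i<sl → trans (val′ i) (trans (cong (_+ (δ t i + δ l i)) (val i i<sl)) (lowered+δδ i))
    where open ChoudumStep l a mono eg t t<l run run-end (n≢0⇒n>0 al≢0)

-- Graphs: handshake and necessity of the Erdős–Gallai inequalities

private
  variable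
    A B : Set

sum-map-+ : ∀ (f g : A → ℕ) xs → sum (map (λ x → f x + g x) xs) ≡ sum (map f xs) + sum (map g xs)
sum-map-+ f g []       = refl
sum-map-+ f g (x ∷ xs) = trans (cong (f x + g x +_) (sum-map-+ f g xs)) (lemma (f x) (g x) _ _)
  where
  lemma : ∀ a b c d → a + b + (c + d) ≡ a + c + (b + d)
  lemma = solve-∀

sum-map-mono : ∀ {f g : A → ℕ} xs → (∀ x → x ∈ xs → f x ≤ g x) → sum (map f xs) ≤ sum (map g xs)
sum-map-mono []       f≤g = z≤n
sum-map-mono (x ∷ xs) f≤g = +-mono-≤ (f≤g x (here refl)) (sum-map-mono xs λ y y∈xs → f≤g y (there y∈xs))

sum-map-const : ∀ c (xs : List A) → sum (map (λ _ → c) xs) ≡ length xs * c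
sum-map-const c []       = refl
sum-map-const c (x ∷ xs) = cong (c +_) (sum-map-const c xs)

sum-map-* : ∀ c (f : A → ℕ) xs → sum (map (λ x → c * f x) xs) ≡ c * sum (map f xs)
sum-map-* c f []       = sym (*-zeroʳ c)
sum-map-* c f (x ∷ xs) = trans (cong (c * f x +_) (sum-map-* c f xs)) (sym (*-distribˡ-+ c (f x) _))

sum-map-++ : ∀ (f : A → ℕ) xs ys → sum (map f (xs ++ ys)) ≡ sum (map f xs) + sum (map f ys)
sum-map-++ f xs ys = trans (cong sum (map-++ f xs ys)) (sum-++ (map f xs) (map f ys))

sum-map-↭ : ∀ (f : A → ℕ) {xs ys} → xs ↭ ys → sum (map f xs) ≡ sum (map f ys)
sum-map-↭ f p = sum-↭ (map⁺ f p)

sum-map-swap : ∀ (f : A → B → ℕ) xs ys →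
               sum (map (λ x → sum (map (f x) ys)) xs) ≡ sum (map (λ y → sum (map (λ x → f x y) xs)) ys)
sum-map-swap f []       ys = sym (trans (sum-map-const 0 ys) (*-zeroʳ (length ys)))
sum-map-swap f (x ∷ xs) ys = trans (cong (sum (map (f x) ys) +_) (sum-map-swap f xs ys))
                                   (sym (sum-map-+ (f x) _ ys))

𝟙 : Bool → ℕ
𝟙 b = if b then 1 else 0

𝟙-split-<ᵇ : ∀ b m n → (m ≡ n → b ≡ false) → 𝟙 b ≡ 𝟙 (b ∧ (m <ᵇ n)) + 𝟙 (b ∧ (n <ᵇ m))
𝟙-split-<ᵇ false m       n       h = refl
𝟙-split-<ᵇ true  zero    zero    h with h refl
... | ()
𝟙-split-<ᵇ true  zero    (suc n) h = refl
𝟙-split-<ᵇ true  (suc m) zero    h = refl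
𝟙-split-<ᵇ true  (suc m) (suc n) h = 𝟙-split-<ᵇ true m n (h ∘ cong suc)

𝟙≤1 : ∀ b → 𝟙 b ≤ 1
𝟙≤1 false = z≤n
𝟙≤1 true  = ≤-refl

module _ {p : ℕ} (G : SimpleGraph p) where

  open ≤-Reasoning

  e : Fin p → Fin p → ℕ
  e i j = 𝟙 (adj G i j)

  handshake : sum (map (degree G) (allFin p)) ≡ edges G + edges G
  handshake = begin-equality
    sum (map (degree G) V)                                        ≡⟨ cong sum (map-cong split V) ⟩
    sum (map (λ i → sum (map (up i) V) + sum (map (down i) V)) V) ≡⟨ sum-map-+ _ _ V ⟩
    edges G + sum (map (λ i → sum (map (down i) V)) V)            ≡⟨ cong (edges G +_) (sum-map-swap down V V) ⟩
    edges G + sum (map (λ j → sum (map (λ i → down i j) V)) V)    ≡⟨ cong (edges G +_) (cong sum (map-cong (λ j → cong sum (map-cong (λ i → cong (λ b → 𝟙 (b ∧ (toℕ j <ᵇ toℕ i))) (SimpleGraph.sym G i j)) V)) V)) ⟩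
    edges G + edges G                                             ∎
    where
    V = allFin p
    up down : Fin p → Fin p → ℕ
    up i j = 𝟙 (adj G i j ∧ (toℕ i <ᵇ toℕ j))
    down i j = 𝟙 (adj G i j ∧ (toℕ j <ᵇ toℕ i))
    split : ∀ i → degree G i ≡ sum (map (up i) V) + sum (map (down i) V)
    split i = trans (cong sum (map-cong (λ j → 𝟙-split-<ᵇ (adj G i j) (toℕ i) (toℕ j)
                      (λ eq → trans (cong (adj G i) (sym (toℕ-injective eq))) (irrefl G i))) V))
                    (sum-map-+ (up i) (down i) V)

  degree-within : ∀ v X → v ∈ X → suc (sum (map (e v) X)) ≤ length X
  degree-within v (w ∷ X) (here refl) rewrite irrefl G v =
    s≤s (≤-trans (sum-map-mono X λ w _ → 𝟙≤1 (adj G v w)) (≤-reflexive (trans (sum-map-const 1 X) (*-identityʳ _))))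
  degree-within v (w ∷ X) (there v∈X) =
    ≤-trans (≤-reflexive (sym (+-suc (e v w) _))) (+-mono-≤ (𝟙≤1 (adj G v w)) (degree-within v X v∈X))

  -- Edges inside X are counted by ordered pairs, and each vertex of Y sends at most `length X` and
  -- at most its own degree into X. X is an arbitrary set of vertices rather than one of largest
  -- degrees, because the vertices matched with a sequence later on need not come in order of
  -- degree.
  erdős-gallai-necessary : ∀ X Y → X ++ Y ↭ allFin p →
    sum (map (degree G) X) ≤ length X * (length X ∸ 1) + sum (map (λ v → length X ⊓ degree G v) Y)
  erdős-gallai-necessary X Y X++Y↭V = begin
    sum (map (degree G) X)                                                     ≡⟨ cong sum (map-cong split X) ⟩
    sum (map (λ v → sum (map (e v) X) + sum (map (e v) Y)) X)                  ≡⟨ sum-map-+ _ _ X ⟩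
    sum (map (λ v → sum (map (e v) X)) X) + sum (map (λ v → sum (map (e v) Y)) X)
                                                                               ≤⟨ +-mono-≤ inside outside ⟩
    length X * (length X ∸ 1) + sum (map (λ v → length X ⊓ degree G v) Y)      ∎
    where
    split : ∀ v → degree G v ≡ sum (map (e v) X) + sum (map (e v) Y)
    split v = trans (sym (sum-map-↭ (e v) X++Y↭V)) (sum-map-++ (e v) X Y)
    inside : sum (map (λ v → sum (map (e v) X)) X) ≤ length X * (length X ∸ 1)
    inside = ≤-trans (sum-map-mono X λ v v∈X → ∸-monoˡ-≤ 1 (degree-within v X v∈X))
                     (≤-reflexive (sum-map-const (length X ∸ 1) X))
    outside : sum (map (λ v → sum (map (e v) Y)) X) ≤ sum (map (λ v → length X ⊓ degree G v) Y)
    outside = begin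
      sum (map (λ v → sum (map (e v) Y)) X)             ≡⟨ sum-map-swap e X Y ⟩
      sum (map (λ w → sum (map (λ v → e v w) X)) Y)     ≤⟨ sum-map-mono Y (λ w _ → ⊓-glb (to-X w) (in-degree w)) ⟩
      sum (map (λ v → length X ⊓ degree G v) Y)         ∎
      where
      to-X : ∀ w → sum (map (λ v → e v w) X) ≤ length X
      to-X w = ≤-trans (sum-map-mono X λ v _ → 𝟙≤1 (adj G v w)) (≤-reflexive (trans (sum-map-const 1 X) (*-identityʳ _)))
      in-degree : ∀ w → sum (map (λ v → e v w) X) ≤ degree G w
      in-degree w = begin
        sum (map (λ v → e v w) X)                     ≡⟨ cong sum (map-cong (λ v → cong 𝟙 (SimpleGraph.sym G v w)) X) ⟩
        sum (map (e w) X)                             ≤⟨ m≤m+n _ _ ⟩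
        sum (map (e w) X) + sum (map (e w) Y)         ≡⟨ split w ⟨
        degree G w                                    ∎

-- Weighing degrees against a sequence that they dominate

-- For `k ≤ d` all the minima are k; for `d ≤ k` the factor d comes out and `k ⊓_` grows with slope
-- at most 1. This prices the excess of a degree y over the term x that it dominates.
⊓-weight : ∀ d k x y → d ≤ x → x ≤ y → d * (k ⊓ y) + (k ⊓ d) * x ≤ d * (k ⊓ x) + (k ⊓ d) * y
⊓-weight d k x y d≤x x≤y with ≤-total k d
... | inj₁ k≤d rewrite m≤n⇒m⊓n≡m k≤d | m≤n⇒m⊓n≡m (≤-trans k≤d d≤x) | m≤n⇒m⊓n≡m (≤-trans k≤d (≤-trans d≤x x≤y)) =
  +-monoʳ-≤ (d * k) (*-monoʳ-≤ k x≤y)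
... | inj₂ d≤k rewrite m≥n⇒m⊓n≡n d≤k | sym (*-distribˡ-+ d (k ⊓ y) x) | sym (*-distribˡ-+ d (k ⊓ x) y) =
  *-monoʳ-≤ d (concave k x y x≤y)
  where
  concave : ∀ k x y → x ≤ y → k ⊓ y + x ≤ k ⊓ x + y
  concave k x y x≤y with ≤-total k x
  ... | inj₁ k≤x rewrite m≤n⇒m⊓n≡m k≤x = +-mono-≤ (m⊓n≤m k y) x≤y
  ... | inj₂ x≤k rewrite m≥n⇒m⊓n≡n x≤k = ≤-trans (+-monoˡ-≤ x (m⊓n≤n k y)) (≤-reflexive (+-comm y x))

-- The counterpart for a vertex matched with no term: per unit of degree it contributes at most what
-- a copy of d does.
⊓-weight₀ : ∀ d k y → d ≤ y → d * (k ⊓ y) ≤ (k ⊓ d) * y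
⊓-weight₀ d k y d≤y with ≤-total k d
... | inj₁ k≤d rewrite m≤n⇒m⊓n≡m k≤d | m≤n⇒m⊓n≡m (≤-trans k≤d d≤y) = ≤-trans (*-monoˡ-≤ k d≤y) (≤-reflexive (*-comm y k))
... | inj₂ d≤k rewrite m≥n⇒m⊓n≡n d≤k = *-monoʳ-≤ d (m⊓n≤n k y)

sum-take-≤ : ∀ k {s t} → Pointwise _≤_ s t → sum (take k s) ≤ sum (take k t)
sum-take-≤ zero    _               = z≤n
sum-take-≤ (suc k) []              = z≤n
sum-take-≤ (suc k) (x≤y ∷ s≤t)     = +-mono-≤ x≤y (sum-take-≤ k s≤t)

-- The position j and the cap k are separate so that the recursion can consume j while k stays
-- fixed; the application has j equal to k.
⊓-weight-drop : ∀ d j k {s t} → All (d ≤_) s → Pointwise _≤_ s t →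
  d * sum (map (k ⊓_) (drop j t)) + (k ⊓ d) * sum (drop j s) ≤ d * sum (map (k ⊓_) (drop j s)) + (k ⊓ d) * sum (drop j t)
⊓-weight-drop d zero    k []        []          = ≤-refl
⊓-weight-drop d (suc j) k []        []          = ≤-refl
⊓-weight-drop d (suc j) k (_ ∷ d≤s) (_ ∷ s≤t)   = ⊓-weight-drop d j k d≤s s≤t
⊓-weight-drop d zero    k {x ∷ s} {y ∷ t} (d≤x ∷ d≤s) (x≤y ∷ s≤t) = begin
  d * (k ⊓ y + T′) + b * (x + sum s)                  ≡⟨ regroup d (k ⊓ y) T′ b x (sum s) ⟩
  d * (k ⊓ y) + b * x + (d * T′ + b * sum s)          ≤⟨ +-mono-≤ (⊓-weight d k x y d≤x x≤y) (⊓-weight-drop d zero k d≤s s≤t) ⟩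
  d * (k ⊓ x) + b * y + (d * S′ + b * sum t)          ≡⟨ regroup d (k ⊓ x) S′ b y (sum t) ⟨
  d * (k ⊓ x + S′) + b * (y + sum t)                  ∎
  where
  open ≤-Reasoning
  b = k ⊓ d
  S′ = sum (map (k ⊓_) s)
  T′ = sum (map (k ⊓_) t)
  regroup : ∀ d u v b x s → d * (u + v) + b * (x + s) ≡ d * u + b * x + (d * v + b * s)
  regroup = solve-∀

sum-take+drop : ∀ k s → sum (take k s) + sum (drop k s) ≡ sum s
sum-take+drop k s = trans (sym (sum-++ (take k s) (drop k s))) (cong sum (take++drop≡id k s))

pointwise-length : ∀ {s t : List ℕ} → Pointwise _≤_ s t → length s ≡ length t
pointwise-length []        = refl
pointwise-length (_ ∷ s≤t) = cong suc (pointwise-length s≤t)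

-- Excess degree in the head only raises the left side, so necessity can be applied to the true
-- degrees there. Excess in the matched tail is priced by `⊓-weight`, and the unmatched vertices by
-- `⊓-weight₀`. All terms are moved so that no subtraction remains.
degree-sum-bound : ∀ {p} (G : SimpleGraph p) d k s vs rest → vs ++ rest ↭ allFin p →
  Pointwise _≤_ s (map (degree G) vs) → All (d ≤_) s → (∀ v → d ≤ degree G v) → k ≤ length s →
  d * sum (take k s) + (k ⊓ d) * sum s
    ≤ d * (k * (k ∸ 1) + sum (map (k ⊓_) (drop k s))) + (k ⊓ d) * sum (map (degree G) (allFin p))
degree-sum-bound {p} G d k s vs rest vs++rest↭V s≤deg d≤s d≤deg k≤s = begin
  d * P + b * sum s                              ≡⟨ cong (λ z → d * P + b * z) (sum-take+drop k s) ⟨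
  d * P + b * (P + P′)                           ≤⟨ +-mono-≤ (*-monoʳ-≤ d P≤X) (*-monoʳ-≤ b (+-monoˡ-≤ P′ P≤X)) ⟩
  d * X + b * (X + P′)                           ≤⟨ +-monoˡ-≤ (b * (X + P′)) (*-monoʳ-≤ d necessary) ⟩
  d * (K + (U + W)) + b * (X + P′)               ≡⟨ regroup₁ d K U W b X P′ ⟩
  d * K + b * X + (d * U + b * P′ + d * W)       ≤⟨ +-monoʳ-≤ (d * K + b * X) (+-mono-≤ (⊓-weight-drop d k k d≤s s≤deg) W≤Z) ⟩
  d * K + b * X + (d * V + b * Y + b * Z)        ≡⟨ regroup₂ d K V b X Y Z ⟩
  d * (K + V) + b * (X + Y + Z)                  ≡⟨ cong (λ z → d * (K + V) + b * z) total ⟩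
  d * (K + V) + b * sum (map (degree G) (allFin p)) ∎
  where
  open ≤-Reasoning
  deg = degree G
  b = k ⊓ d
  P = sum (take k s)
  P′ = sum (drop k s)
  X = sum (take k (map deg vs))
  Y = sum (drop k (map deg vs))
  Z = sum (map deg rest)
  K = k * (k ∸ 1)
  U = sum (map (k ⊓_) (drop k (map deg vs)))
  V = sum (map (k ⊓_) (drop k s))
  W = sum (map (λ v → k ⊓ deg v) rest)
  regroup₁ : ∀ d K U W b X P → d * (K + (U + W)) + b * (X + P) ≡ d * K + b * X + (d * U + b * P + d * W)
  regroup₁ = solve-∀
  regroup₂ : ∀ d K V b X Y Z → d * K + b * X + (d * V + b * Y + b * Z) ≡ d * (K + V) + b * (X + Y + Z)
  regroup₂ = solve-∀
  P≤X : P ≤ X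
  P≤X = sum-take-≤ k s≤deg
  W≤Z : d * W ≤ b * Z
  W≤Z = subst₂ _≤_ (sum-map-* d (λ v → k ⊓ deg v) rest) (sum-map-* b deg rest)
               (sum-map-mono rest λ v _ → ⊓-weight₀ d k (deg v) (d≤deg v))
  total : X + Y + Z ≡ sum (map deg (allFin p))
  total = trans (cong (_+ Z) (sum-take+drop k (map deg vs)))
                (trans (sym (sum-map-++ deg vs rest)) (sum-map-↭ deg vs++rest↭V))
  length-X : length (take k vs) ≡ k
  length-X = trans (length-take k vs) (m≤n⇒m⊓n≡m (subst (k ≤_) (trans (pointwise-length s≤deg) (length-map deg vs)) k≤s))
  necessary : X ≤ K + (U + W)
  necessary = begin
    X                                                                     ≡⟨ cong sum (take-map k vs) ⟩
    sum (map deg (take k vs))                                             ≤⟨ erdős-gallai-necessary G (take k vs) (drop k vs ++ rest) (↭-trans (↭-reflexive (trans (sym (++-assoc (take k vs) _ rest)) (cong (_++ rest) (take++drop≡id k vs)))) vs++rest↭V) ⟩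
    length (take k vs) * (length (take k vs) ∸ 1) + sum (map (λ v → length (take k vs) ⊓ deg v) (drop k vs ++ rest))
                                                                          ≡⟨ cong (λ z → z * (z ∸ 1) + sum (map (λ v → z ⊓ deg v) (drop k vs ++ rest))) length-X ⟩
    K + sum (map (λ v → k ⊓ deg v) (drop k vs ++ rest))                   ≡⟨ cong (K +_) (sum-map-++ _ (drop k vs) rest) ⟩
    K + (sum (map (λ v → k ⊓ deg v) (drop k vs)) + W)                     ≡⟨ cong (λ z → K + (sum z + W)) (trans (map-∘ (drop k vs)) (cong (map (k ⊓_)) (sym (drop-map k vs)))) ⟩
    K + (U + W)                                                           ∎

complete-to : ∀ (ws ys : List A) → Unique ws → (∀ {w} → w ∈ ws → w ∈ ys) → ∃ λ rest → ws ++ rest ↭ ys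
complete-to []       ys _ _ = ys , ↭-refl
complete-to (w ∷ ws) ys (w∉ws ∷ uniq) ws⊆ys with ∈-∃++ (ws⊆ys (here refl))
... | ys₁ , ys₂ , refl with complete-to ws (ys₁ ++ ys₂) uniq ws⊆
  where
  ws⊆ : ∀ {u} → u ∈ ws → u ∈ ys₁ ++ ys₂
  ws⊆ u∈ws with ∈-++⁻ ys₁ (ws⊆ys (there u∈ws))
  ... | inj₁ u∈ys₁         = ∈-++⁺ˡ u∈ys₁
  ... | inj₂ (here refl)   = contradiction refl (All.lookup w∉ws u∈ws)
  ... | inj₂ (there u∈ys₂) = ∈-++⁺ʳ ys₁ u∈ys₂
...   | rest , p = rest , ↭-trans (prep w p) (↭-sym (shift w ys₁ ys₂))

-- The number of added copies

-- With Δ = Q - P, a nonnegative ceiling c of -Δ / b is determined by the two inequalities: c steps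
-- of size b suffice and overshoot by less than b. Of a negative ceiling only the sign of Δ is kept.
ceilDiv-cases : ∀ Q P b → 0 < b →
  let q = ceilDiv (ℤ.- (ℤ.+ Q ℤ.- ℤ.+ P)) b in
  (∃ λ c → q ≡ ℤ.+ c × P ≤ Q + c * b × Q + c * b < P + b) ⊎ (∃ λ m → q ≡ ℤ.-[1+ m ] × P < Q)
-- The ceiling of -Δ / b is minus the floor of Δ / b. After the double negation is removed,
-- Euclidean division of Q - P gives the quotient -c and a remainder r with Q + c b = r + P.
ceilDiv-cases Q P (suc b) _ rewrite ℤ.neg-involutive (ℤ.+ Q ℤ.- ℤ.+ P) =
  cases _ _ (ℤ.a≡a%ℕn+[a/ℕn]*n (ℤ.+ Q ℤ.- ℤ.+ P) (suc b)) (ℤ.n%ℕd<d (ℤ.+ Q ℤ.- ℤ.+ P) (suc b))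
  where
  move : ∀ x y r q c → x ℤ.- y ≡ r ℤ.+ q ℤ.* c → x ≡ r ℤ.+ q ℤ.* c ℤ.+ y
  move x y r q c eq = trans (lemma x y) (cong (ℤ._+ y) eq)
    where
    lemma : ∀ x y → x ≡ x ℤ.- y ℤ.+ y
    lemma = ℤ-Solver.solve-∀
  move⁻ : ∀ x y r q c → x ℤ.- y ≡ r ℤ.+ (ℤ.- q) ℤ.* c → x ℤ.+ q ℤ.* c ≡ r ℤ.+ y
  move⁻ x y r q c eq = trans (lemma₁ x y q c) (trans (cong (ℤ._+ (y ℤ.+ q ℤ.* c)) eq) (lemma₂ y r q c))
    where
    lemma₁ : ∀ x y q c → x ℤ.+ q ℤ.* c ≡ x ℤ.- y ℤ.+ (y ℤ.+ q ℤ.* c)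
    lemma₁ = ℤ-Solver.solve-∀
    lemma₂ : ∀ y r q c → r ℤ.+ (ℤ.- q) ℤ.* c ℤ.+ (y ℤ.+ q ℤ.* c) ≡ r ℤ.+ y
    lemma₂ = ℤ-Solver.solve-∀
  cases : ∀ q r → ℤ.+ Q ℤ.- ℤ.+ P ≡ ℤ.+ r ℤ.+ q ℤ.* ℤ.+ suc b → r < suc b →
          (∃ λ c → ℤ.- q ≡ ℤ.+ c × P ≤ Q + c * suc b × Q + c * suc b < P + suc b)
          ⊎ (∃ λ m → ℤ.- q ≡ ℤ.-[1+ m ] × P < Q)
  cases (ℤ.+ zero) r eq r<b = inj₁ (0 , refl , subst₂ _≤_ refl (sym (+-identityʳ Q)) (subst (P ≤_) (sym Q≡) (m≤n+m P r))
      , subst (_< P + suc b) (sym (trans (+-identityʳ Q) (trans Q≡ (+-comm r P)))) (+-monoʳ-< P r<b))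
    where
    Q≡ : Q ≡ r + P
    Q≡ = ℤ.+-injective (trans (move (ℤ.+ Q) (ℤ.+ P) (ℤ.+ r) (ℤ.+ 0) (ℤ.+ suc b) eq) (cong (ℤ._+ ℤ.+ P) (ℤ.+-identityʳ (ℤ.+ r))))
  cases (ℤ.+ suc m) r eq r<b = inj₂ (m , refl , subst (P <_) (sym Q≡) (m<n+m P (≤-trans (s≤s z≤n) (m≤n+m (suc m * suc b) r))))
    where
    Q≡ : Q ≡ r + suc m * suc b + P
    Q≡ = ℤ.+-injective (trans (move (ℤ.+ Q) (ℤ.+ P) (ℤ.+ r) (ℤ.+ suc m) (ℤ.+ suc b) eq)
                              (cong (λ z → ℤ.+ r ℤ.+ z ℤ.+ ℤ.+ P) (sym (ℤ.pos-* (suc m) (suc b)))))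
  cases (ℤ.-[1+ m ]) r eq r<b = inj₁ (suc m , refl , subst (P ≤_) (sym Q≡) (m≤n+m P r)
      , subst (_< P + suc b) (sym (trans Q≡ (+-comm r P))) (+-monoʳ-< P r<b))
    where
    Q≡ : Q + suc m * suc b ≡ r + P
    Q≡ = ℤ.+-injective (trans (cong (λ z → ℤ.+ Q ℤ.+ z) (ℤ.pos-* (suc m) (suc b)))
                              (move⁻ (ℤ.+ Q) (ℤ.+ P) (ℤ.+ r) (ℤ.+ suc m) (ℤ.+ suc b) eq))

maxK-upper : ∀ f M k → 1 ≤ k → k ≤ M → f k ℤ.≤ maxK f M
maxK-upper f M (suc k) _ k<M = upper (map suc (upTo M)) (∈-map⁺ suc (∈-upTo⁺ k<M))
  where
  upper : ∀ ks → suc k ∈ ks → f (suc k) ℤ.≤ foldr (λ k acc → f k ℤ.⊔ acc) (f 1) ks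
  upper (j ∷ ks) (here refl)  = ℤ.i≤i⊔j (f j) _
  upper (j ∷ ks) (there k∈ks) = ℤ.≤-trans (upper ks k∈ks) (ℤ.i≤j⊔i (f j) _)

-- The seed `f 1` of the fold is itself a value in the range, as `1 ≤ M`.
maxK-attained : ∀ f M → 1 ≤ M → ∃ λ k → 1 ≤ k × k ≤ M × maxK f M ≡ f k
maxK-attained f M 1≤M with attained (map suc (upTo M))
  where
  attained : ∀ ks → ∃ λ k → (k ≡ 1 ⊎ k ∈ ks) × foldr (λ k acc → f k ℤ.⊔ acc) (f 1) ks ≡ f k
  attained []       = 1 , inj₁ refl , refl
  attained (j ∷ ks) with ℤ.⊔-sel (f j) (foldr (λ k acc → f k ℤ.⊔ acc) (f 1) ks) | attained ks
  ... | inj₁ eq | _                 = j , inj₂ (here refl) , eq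
  ... | inj₂ eq | k , inj₁ k≡1 , eq′  = k , inj₁ k≡1 , trans eq eq′
  ... | inj₂ eq | k , inj₂ k∈ks , eq′ = k , inj₂ (there k∈ks) , trans eq eq′
... | k , inj₁ refl , eq = 1 , ≤-refl , 1≤M , eq
... | k , inj₂ k∈ , eq with ∈-map⁻ suc k∈
...   | j , j∈ , refl = suc j , s≤s z≤n , ∈-upTo⁻ j∈ , eq

-- `Δ s k` is `egRight s k` minus `egLeft s k`; with the two parts separate, the inequalities live
-- in ℕ.
egRight : List ℕ → ℕ → ℕ
egRight s k = k * (k ∸ 1) + sum (map (k ⊓_) (drop k s))

egLeft : List ℕ → ℕ → ℕ
egLeft s k = sum (take k s)

-- The hypothesis on k = 1 makes the maximum nonnegative, so that taking its absolute value is harmless.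
copies-spec : ∀ s d M → 0 < d → 1 ≤ M → egRight s 1 ≤ egLeft s 1 →
  let c = ℤ.∣ maxK (term s d) M ∣ in
  (∀ k → 1 ≤ k → k ≤ M → egLeft s k ≤ egRight s k + c * (k ⊓ d))
  × (∃ λ k → 1 ≤ k × k ≤ M × egRight s k + c * (k ⊓ d) < egLeft s k + k ⊓ d)
copies-spec s d M 0<d 1≤M first = upper , attained (maxK-attained (term s d) M 1≤M)
  where
  c = ℤ.∣ maxK (term s d) M ∣

  0<k⊓d : ∀ {k} → 1 ≤ k → 0 < k ⊓ d
  0<k⊓d 1≤k = ⊓-glb 1≤k 0<d

  nonneg : ℤ.+ 0 ℤ.≤ maxK (term s d) M
  nonneg with ceilDiv-cases (egRight s 1) (egLeft s 1) (1 ⊓ d) (0<k⊓d ≤-refl)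
  ... | inj₁ (c , eq , _) = ℤ.≤-trans (subst (ℤ.+ 0 ℤ.≤_) (sym eq) (ℤ.+≤+ z≤n)) (maxK-upper (term s d) M 1 ≤-refl 1≤M)
  ... | inj₂ (_ , _ , lt) = contradiction first (<⇒≱ lt)

  max≡c : maxK (term s d) M ≡ ℤ.+ c
  max≡c = sym (ℤ.0≤i⇒+∣i∣≡i nonneg)

  upper : ∀ k → 1 ≤ k → k ≤ M → egLeft s k ≤ egRight s k + c * (k ⊓ d)
  upper k 1≤k k≤M with ceilDiv-cases (egRight s k) (egLeft s k) (k ⊓ d) (0<k⊓d 1≤k)
  ... | inj₂ (_ , _ , lt) = ≤-trans (<⇒≤ lt) (m≤m+n _ _)
  ... | inj₁ (c′ , eq , le , _) = ≤-trans le (+-monoʳ-≤ (egRight s k) (*-monoˡ-≤ (k ⊓ d)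
          (ℤ.drop‿+≤+ (subst₂ ℤ._≤_ eq max≡c (maxK-upper (term s d) M k 1≤k k≤M)))))

  attained : (∃ λ k → 1 ≤ k × k ≤ M × maxK (term s d) M ≡ term s d k) →
             ∃ λ k → 1 ≤ k × k ≤ M × egRight s k + c * (k ⊓ d) < egLeft s k + k ⊓ d
  attained (k , 1≤k , k≤M , max≡) with ceilDiv-cases (egRight s k) (egLeft s k) (k ⊓ d) (0<k⊓d 1≤k)
  ... | inj₁ (c′ , eq , _ , lt) = k , 1≤k , k≤M
        , subst (λ z → egRight s k + z * (k ⊓ d) < egLeft s k + k ⊓ d) (ℤ.+-injective (trans (sym eq) (trans (sym max≡) max≡c))) lt
  ... | inj₂ (_ , eq , _) with trans (sym eq) (trans (sym max≡) max≡c)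
  ...   | ()

-- Extending a sequence by copies of its last term

-- The default d is chosen as the repeated last term, so that the function is constantly d from the
-- start of the final run onwards, even past the end of the list.
at : List ℕ → ℕ → ℕ → ℕ
at []       d i       = d
at (x ∷ xs) d zero    = x
at (x ∷ xs) d (suc i) = at xs d i

lookup≡at : ∀ l d k → lookup l k ≡ at l d (toℕ k)
lookup≡at (x ∷ l) d Fin.zero    = refl
lookup≡at (x ∷ l) d (Fin.suc k) = lookup≡at l d k

∑-at-take : ∀ l d k → k ≤ length l → ∑ k (at l d) ≡ sum (take k l)
∑-at-take l       d zero    _   = refl
∑-at-take (x ∷ l) d (suc k) k≤l = cong (x +_) (∑-at-take l d k (s≤s⁻¹ k≤l))

∑-at-drop : ∀ l d f k m → k + m ≡ length l → ∑ m (λ j → f (at l d (k + j))) ≡ sum (map f (drop k l))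
∑-at-drop []      d f zero    zero    _  = refl
∑-at-drop (x ∷ l) d f zero    (suc m) eq = cong (f x +_) (∑-at-drop l d f zero m (suc-injective eq))
∑-at-drop (x ∷ l) d f (suc k) m       eq = ∑-at-drop l d f k m (suc-injective eq)

at-nonIncreasing : ∀ l d → Linked _≥_ l → NonIncreasing (length l) (at l d)
at-nonIncreasing (x ∷ l)     d _           zero    zero    _   _   = ≤-refl
at-nonIncreasing (x ∷ [])    d _           _       (suc j) _   (s<s ())
at-nonIncreasing (x ∷ y ∷ l) d (x≥y ∷ lnk) zero    (suc j) _   j<  =
  ≤-trans (at-nonIncreasing (y ∷ l) d lnk 0 j z≤n (s<s⁻¹ j<)) x≥y
at-nonIncreasing (x ∷ y ∷ l) d (_ ∷ lnk)   (suc i) (suc j) i≤j j<  =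
  at-nonIncreasing (y ∷ l) d lnk i j (s≤s⁻¹ i≤j) (s<s⁻¹ j<)

at-replicate : ∀ ys d m i → length ys ≤ i → at (ys ++ replicate m d) d i ≡ d
at-replicate (y ∷ ys) d m       (suc i) ys≤i = at-replicate ys d m i (s≤s⁻¹ ys≤i)
at-replicate []       d zero    i       _    = refl
at-replicate []       d (suc m) zero    _    = refl
at-replicate []       d (suc m) (suc i) _    = at-replicate [] d m i z≤n

sum-allFin : ∀ p f → sum (map (f ∘ toℕ) (allFin p)) ≡ ∑ p f
sum-allFin p f = trans (cong sum (map-tabulate {n = p} id (f ∘ toℕ))) (go p f)
  where
  go : ∀ p f → sum (tabulate {n = p} (f ∘ toℕ)) ≡ ∑ p f
  go zero    f = refl
  go (suc p) f = cong (f 0 +_) (go p (f ∘ suc))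

realised⇒graphic : ∀ l d → Linked _≥_ l → Realised (length l) (at l d) → Graphic l
realised⇒graphic l d lnk (H , val) = lnk , G , λ k → trans (degree≡ k) (trans (val (toℕ k) (toℕ<n k)) (sym (lookup≡at l d k)))
  where
  G : SimpleGraph (length l)
  adj G i j = entry H (toℕ i) (toℕ j) ≡ᵇ 1
  SimpleGraph.sym G i j = cong (_≡ᵇ 1) (symmetric H (toℕ i) (toℕ j))
  irrefl G i = cong (_≡ᵇ 1) (loopless H (toℕ i))
  𝟙-≡ᵇ1 : ∀ x → x ≤ 1 → 𝟙 (x ≡ᵇ 1) ≡ x
  𝟙-≡ᵇ1 zero       _ = refl
  𝟙-≡ᵇ1 (suc zero) _ = refl
  𝟙-≡ᵇ1 (suc (suc _)) (s≤s ())
  degree≡ : ∀ k → degree G k ≡ valency H (toℕ k)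
  degree≡ k = trans (cong sum (map-cong (λ j → 𝟙-≡ᵇ1 _ (entry≤1 H (toℕ k) (toℕ j))) (allFin (length l))))
                    (sum-allFin (length l) (entry H (toℕ k)))

-- Passing from k to k + 1 adds d on the left and 2k to the product on the right. If `d ≤ k`, the
-- tail loses d, and 2k - d ≥ d. If k < d, the tail loses one k while each of its m other terms
-- gains 1, a net gain of k + m on the right.
plateau-step : ∀ S d k m → d ≤ k + m → S ≤ k * (k ∸ 1) + suc m * (k ⊓ d) → S + d ≤ suc k * k + m * (suc k ⊓ d)
plateau-step S d k m d≤n-1 h with d ≤? k
... | yes d≤k rewrite m≥n⇒m⊓n≡n d≤k | m≥n⇒m⊓n≡n (m≤n⇒m≤1+n d≤k) = begin
  S + d                                      ≤⟨ +-monoˡ-≤ d h ⟩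
  k * (k ∸ 1) + suc m * d + d                ≡⟨ regroup (k * (k ∸ 1)) m d ⟩
  k * (k ∸ 1) + (d + d) + m * d              ≤⟨ +-monoˡ-≤ (m * d) (+-monoʳ-≤ (k * (k ∸ 1)) (+-mono-≤ d≤k d≤k)) ⟩
  k * (k ∸ 1) + (k + k) + m * d              ≡⟨ cong (_+ m * d) (+-assoc (k * (k ∸ 1)) k k) ⟨
  k * (k ∸ 1) + k + k + m * d                ≡⟨ cong (λ z → z + k + m * d) (k*[k∸1]+k≡k*k k) ⟩
  k * k + k + m * d                          ≡⟨ cong (_+ m * d) (+-comm (k * k) k) ⟩
  suc k * k + m * d                          ∎
  where
  open ≤-Reasoning
  regroup : ∀ K m d → K + suc m * d + d ≡ K + (d + d) + m * d
  regroup = solve-∀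
... | no d≰k rewrite m≤n⇒m⊓n≡m (<⇒≤ (≰⇒> d≰k)) | m≤n⇒m⊓n≡m (≰⇒> d≰k) = begin
  S + d                                      ≤⟨ +-mono-≤ h d≤n-1 ⟩
  k * (k ∸ 1) + suc m * k + (k + m)          ≡⟨ regroup (k * (k ∸ 1)) m k ⟩
  k * (k ∸ 1) + k + k + m * suc k            ≡⟨ cong (λ z → z + k + m * suc k) (k*[k∸1]+k≡k*k k) ⟩
  k * k + k + m * suc k                      ≡⟨ cong (_+ m * suc k) (+-comm (k * k) k) ⟩
  suc k * k + m * suc k                      ∎
  where
  open ≤-Reasoning
  regroup : ∀ K m k → K + suc m * k + (k + m) ≡ K + k + k + m * suc k
  regroup = solve-∀

erdős-gallai-plateau : ∀ a d N n → (∀ i → N ≤ i → a i ≡ d) → d < n →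
  (∀ k m → k ≤ N → k + m ≡ n → ∑ k a ≤ k * (k ∸ 1) + ∑ m (λ j → k ⊓ a (k + j))) → ErdősGallai n a
erdős-gallai-plateau a d N n const d<n early k m k+m≡n with k ≤? N
... | yes k≤N = early k m k≤N k+m≡n
... | no k≰N = subst (∑ k a ≤_) (cong (k * (k ∸ 1) +_) (sym (tail≡ k m (<⇒≤ (≰⇒> k≰N))))) (late k m (<⇒≤ (≰⇒> k≰N)) k+m≡n)
  where
  tail≡ : ∀ k m → N ≤ k → ∑ m (λ j → k ⊓ a (k + j)) ≡ m * (k ⊓ d)
  tail≡ k m N≤k = trans (∑-cong m λ j _ → cong (k ⊓_) (const (k + j) (≤-trans N≤k (m≤m+n k j)))) (∑-const m (k ⊓ d))
  late : ∀ k m → N ≤ k → k + m ≡ n → ∑ k a ≤ k * (k ∸ 1) + m * (k ⊓ d)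
  late k m N≤k k+m≡n with m≤n⇒m<n∨m≡n N≤k
  ... | inj₂ refl = subst (∑ N a ≤_) (cong (N * (N ∸ 1) +_) (tail≡ N m ≤-refl)) (early N m ≤-refl k+m≡n)
  late (suc k) m N≤k k+m≡n | inj₁ N<sk = begin
    ∑ (suc k) a                        ≡⟨ ∑-snoc k a ⟩
    ∑ k a + a k                        ≡⟨ cong (∑ k a +_) (const k (s≤s⁻¹ N<sk)) ⟩
    ∑ k a + d                          ≤⟨ plateau-step (∑ k a) d k m (s≤s⁻¹ (subst (d <_) (sym k+m≡n) d<n)) (late k (suc m) (s≤s⁻¹ N<sk) (trans (+-suc k m) k+m≡n)) ⟩
    suc k * k + m * (suc k ⊓ d)        ∎
    where open ≤-Reasoning

take-++-≤ : ∀ {A : Set} k (xs ys : List A) → k ≤ length xs → take k (xs ++ ys) ≡ take k xs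
take-++-≤ zero    xs       ys _   = refl
take-++-≤ (suc k) (x ∷ xs) ys k≤  = cong (x ∷_) (take-++-≤ k xs ys (s≤s⁻¹ k≤))

drop-++-≤ : ∀ {A : Set} k (xs ys : List A) → k ≤ length xs → drop k (xs ++ ys) ≡ drop k xs ++ ys
drop-++-≤ zero    xs       ys _   = refl
drop-++-≤ (suc k) (x ∷ xs) ys k≤  = drop-++-≤ k xs ys (s≤s⁻¹ k≤)

sum-replicate : ∀ m d → sum (replicate m d) ≡ m * d
sum-replicate zero    d = refl
sum-replicate (suc m) d = cong (d +_) (sum-replicate m d)

sum-++-replicate : ∀ s m d → sum (s ++ replicate m d) ≡ sum s + m * d
sum-++-replicate s m d = trans (sum-++ s (replicate m d)) (cong (sum s +_) (sum-replicate m d))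

linked-++-replicate : ∀ ys d m → Linked _≥_ (ys ++ [ d ]) → Linked _≥_ ((ys ++ [ d ]) ++ replicate m d)
linked-++-replicate []           d zero    _         = [-]
linked-++-replicate []           d (suc m) lnk       = ≤-refl ∷ linked-++-replicate [] d m lnk
linked-++-replicate (y ∷ [])     d m       (p ∷ lnk) = p ∷ linked-++-replicate [] d m lnk
linked-++-replicate (y ∷ z ∷ ys) d m       (p ∷ lnk) = p ∷ linked-++-replicate (z ∷ ys) d m lnk

linked-duplicate : ∀ pre v q → Linked _≥_ (pre ++ v ∷ q) → Linked _≥_ (pre ++ v ∷ v ∷ q)
linked-duplicate []            v q lnk       = ≤-refl ∷ lnk
linked-duplicate (y ∷ [])      v q (p ∷ lnk) = p ∷ linked-duplicate [] v q lnk
linked-duplicate (y ∷ z ∷ pre) v q (p ∷ lnk) = p ∷ linked-duplicate (z ∷ pre) v q lnk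

linked⇒All≥ : ∀ pre v q → Linked _≥_ (pre ++ v ∷ q) → All (v ≤_) pre
linked⇒All≥ []            v q _         = []
linked⇒All≥ (y ∷ [])      v q (p ∷ lnk) = p ∷ []
linked⇒All≥ (y ∷ z ∷ pre) v q (p ∷ lnk) with linked⇒All≥ (z ∷ pre) v q lnk
... | v≤z ∷ rest = ≤-trans v≤z p ∷ v≤z ∷ rest

last-minimal : ∀ ys d → Linked _≥_ (ys ++ [ d ]) → All (d ≤_) (ys ++ [ d ])
last-minimal ys d lnk = All.++⁺ (linked⇒All≥ ys d [] lnk) (≤-refl ∷ [])

graphic-extension : ∀ ys d C → 0 < length ys → Linked _≥_ (ys ++ [ d ]) →
  (∀ k → 1 ≤ k → k ≤ length ys → egLeft (ys ++ [ d ]) k ≤ egRight (ys ++ [ d ]) k + C * (k ⊓ d)) →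
  evenᵇ (sum (ys ++ [ d ]) + C * d) ≡ true → Graphic ((ys ++ [ d ]) ++ replicate C d)
graphic-extension ys d C 0<ys lnk upper even =
  realised⇒graphic l d lnk-l (erdős-gallai (length l) a a-mono
    (trans (cong evenᵇ (trans total (sum-++-replicate s C d))) even)
    (erdős-gallai-plateau a d (length ys) (length l) a-const d<l early))
  where
  s = ys ++ [ d ]
  l = s ++ replicate C d
  a = at l d
  lnk-l : Linked _≥_ l
  lnk-l = linked-++-replicate ys d C lnk
  a-mono : NonIncreasing (length l) a
  a-mono = at-nonIncreasing l d lnk-l
  length-l : length l ≡ length ys + suc C
  length-l = trans (cong length (++-assoc ys [ d ] (replicate C d)))
                   (trans (length-++ ys) (cong (λ z → length ys + suc z) (length-replicate C)))
  a-const : ∀ i → length ys ≤ i → a i ≡ d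
  a-const i ys≤i = trans (cong (λ l → at l d i) (++-assoc ys [ d ] (replicate C d))) (at-replicate ys d (suc C) i ys≤i)
  ys<l : length ys < length l
  ys<l = subst (length ys <_) (sym length-l) (m<m+n (length ys) z<s)
  total : ∑ (length l) a ≡ sum l
  total = trans (∑-at-drop l d id 0 (length l) refl) (cong sum (map-id l))
  ys≤s : length ys ≤ length s
  ys≤s = subst (length ys ≤_) (sym (length-++ ys)) (m≤m+n (length ys) 1)
  early : ∀ k m → k ≤ length ys → k + m ≡ length l → ∑ k a ≤ k * (k ∸ 1) + ∑ m (λ j → k ⊓ a (k + j))
  early zero    m _    _  = z≤n
  early k@(suc _) m k≤ys k+m≡l = begin
    ∑ k a                                               ≡⟨ ∑-at-take l d k (subst (k ≤_) k+m≡l (m≤m+n k m)) ⟩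
    sum (take k l)                                      ≡⟨ cong sum (take-++-≤ k s (replicate C d) k≤s) ⟩
    egLeft s k                                          ≤⟨ upper k (s≤s z≤n) k≤ys ⟩
    egRight s k + C * (k ⊓ d)                           ≡⟨ +-assoc (k * (k ∸ 1)) _ _ ⟩
    k * (k ∸ 1) + (sum (map (k ⊓_) (drop k s)) + C * (k ⊓ d)) ≡⟨ cong (k * (k ∸ 1) +_) tail≡ ⟨
    k * (k ∸ 1) + ∑ m (λ j → k ⊓ a (k + j))             ∎
    where
    open ≤-Reasoning
    k≤s = ≤-trans k≤ys ys≤s
    tail≡ : ∑ m (λ j → k ⊓ a (k + j)) ≡ sum (map (k ⊓_) (drop k s)) + C * (k ⊓ d)
    tail≡ = begin-equality
      ∑ m (λ j → k ⊓ a (k + j))                                       ≡⟨ ∑-at-drop l d (k ⊓_) k m k+m≡l ⟩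
      sum (map (k ⊓_) (drop k l))                                     ≡⟨ cong (sum ∘ map (k ⊓_)) (drop-++-≤ k s (replicate C d) k≤s) ⟩
      sum (map (k ⊓_) (drop k s ++ replicate C d))                    ≡⟨ cong sum (map-++ (k ⊓_) (drop k s) (replicate C d)) ⟩
      sum (map (k ⊓_) (drop k s) ++ map (k ⊓_) (replicate C d))       ≡⟨ cong (λ z → sum (map (k ⊓_) (drop k s) ++ z)) (map-replicate (k ⊓_) C d) ⟩
      sum (map (k ⊓_) (drop k s) ++ replicate C (k ⊓ d))              ≡⟨ sum-++-replicate (map (k ⊓_) (drop k s)) C (k ⊓ d) ⟩
      sum (map (k ⊓_) (drop k s)) + C * (k ⊓ d)                       ∎
  -- The inequality at k = 1, already available from `early`, gives d ≤ `a 0` ≤ `length l` - 1.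
  d<l : d < length l
  d<l with length l in eq
  ... | zero  = contradiction (subst (length ys <_) eq ys<l) n≮0
  ... | suc n = s≤s (≤-trans (≤-trans (≤-reflexive (sym (a-const (length ys) ≤-refl))) (a-mono 0 (length ys) z≤n ys<l))
                             (first≤n-1 n a (early 1 n 0<ys (sym eq))))

-- The lower bound on the number of edges

bound-extension : ∀ {p} (G : SimpleGraph p) d c s vs rest → 0 < d → vs ++ rest ↭ allFin p →
  Pointwise _≤_ s (map (degree G) vs) → All (d ≤_) s → (∀ v → d ≤ degree G v) →
  (∃ λ k → 1 ≤ k × k ≤ length s × egRight s k + c * (k ⊓ d) < egLeft s k + k ⊓ d) →
  sum s + c * d < 2 * edges G + d
bound-extension {p} G d c s vs rest 0<d perm s≤deg d≤s d≤deg (k , 1≤k , k≤s , lt) =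
  subst (λ z → sum s + c * d < z + d) (trans (handshake G) (cong (edges G +_) (sym (+-identityʳ (edges G)))))
  -- The strict ceiling inequality at the maximising k is scaled by d to meet `degree-sum-bound`;
  -- the common `d * R` and the positive factor `b` then cancel, so no division occurs.
  (*-cancelˡ-< b _ _ (+-cancelˡ-< (d * R) _ _ (begin-strict
    d * R + b * (sum s + c * d)                    ≡⟨ regroup₁ d R b (sum s) c ⟩
    d * (R + c * b) + b * sum s                    <⟨ +-monoˡ-< (b * sum s) (*-monoʳ-< d ⦃ >-nonZero 0<d ⦄ lt) ⟩
    d * (L + b) + b * sum s                        ≡⟨ regroup₂ d L b (sum s) ⟩
    d * L + b * sum s + d * b                      ≤⟨ +-monoˡ-≤ (d * b) (degree-sum-bound G d k s vs rest perm s≤deg d≤s d≤deg k≤s) ⟩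
    d * R + b * T + d * b                          ≡⟨ regroup₃ d R b T ⟩
    d * R + b * (T + d)                            ∎)))
  where
  open ≤-Reasoning
  b = k ⊓ d
  L = egLeft s k
  R = egRight s k
  T = sum (map (degree G) (allFin p))
  regroup₁ : ∀ d R b S c → d * R + b * (S + c * d) ≡ d * (R + c * b) + b * S
  regroup₁ = solve-∀
  regroup₂ : ∀ d L b S → d * (L + b) + b * S ≡ d * L + b * S + d * b
  regroup₂ = solve-∀
  regroup₃ : ∀ d R b T → d * R + b * T + d * b ≡ d * R + b * (T + d)
  regroup₃ = solve-∀

-- One vertex is chosen for each degree; the chosen vertices are distinct because their degrees are.
representatives : ∀ {p} (G : SimpleGraph p) D → Unique D → HasDegreeSet G D →
                  ∃₂ λ vs rest → map (degree G) vs ≡ D × vs ++ rest ↭ allFin p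
representatives {p} G D uniq (_ , attained) with choose D attained
  where
  choose : ∀ D → (∀ d → d ∈ D → ∃ λ v → degree G v ≡ d) → ∃ λ vs → map (degree G) vs ≡ D
  choose []      _ = [] , refl
  choose (d ∷ D) h with h d (here refl) | choose D (λ d d∈D → h d (there d∈D))
  ... | v , eq | vs , eqs = v ∷ vs , cong₂ _∷_ eq eqs
... | vs , eq with complete-to vs (allFin p) (Unique.map⁻ (subst Unique (sym eq) uniq)) (λ {w} _ → ∈-allFin w)
...   | rest , perm = vs , rest , eq , perm

decreasing⇒unique : ∀ {D} → Linked _>_ D → Unique D
decreasing⇒unique = AllPairs.map >⇒≢ ∘ Linked⇒AllPairs (λ x>y y>z → <-trans y>z x>y)

-- Each step up a strictly decreasing list of positive integers gains at least one. This supplies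
-- the inequality at k = 1 that keeps the maximum nonnegative.
decreasing⇒length≤first : ∀ {D} → Linked _>_ D → All (_> 0) D → length D ≤ sum (take 1 D)
decreasing⇒length≤first []          _           = z≤n
decreasing⇒length≤first {x ∷ []} [-] (x>0 ∷ _)   = ≤-trans x>0 (m≤m+n x 0)
decreasing⇒length≤first {x ∷ y ∷ D} (x>y ∷ lnk) (_ ∷ pos) =
  ≤-trans (s≤s (decreasing⇒length≤first lnk pos)) (+-monoˡ-≤ 0 x>y)

first-inequality : ∀ s → length s ∸ 1 ≤ sum (take 1 s) → egRight s 1 ≤ egLeft s 1
first-inequality s h = begin
  sum (map (1 ⊓_) (drop 1 s))     ≤⟨ sum-map-mono (drop 1 s) (λ x _ → m⊓n≤m 1 x) ⟩
  sum (map (λ _ → 1) (drop 1 s))  ≡⟨ trans (sum-map-const 1 (drop 1 s)) (*-identityʳ _) ⟩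
  length (drop 1 s)               ≡⟨ length-drop 1 s ⟩
  length s ∸ 1                    ≤⟨ h ⟩
  sum (take 1 s)                  ∎
  where open ≤-Reasoning

∈-++-replicate : ∀ {s : List ℕ} {d} m → d ∈ s → ∀ x → x ∈ s ++ replicate m d ⇔ x ∈ s
∈-++-replicate {s} {d} m d∈s x = mk⇔ (λ x∈ → [ id , from-copies m ]′ (∈-++⁻ s x∈)) ∈-++⁺ˡ
  where
  from-copies : ∀ m → x ∈ replicate m d → x ∈ s
  from-copies (suc m) (here refl) = d∈s
  from-copies (suc m) (there x∈)  = from-copies m x∈

-- The bound on half the sum is doubled to stay in ℕ.
Conclusion : List ℕ → ℕ → List ℕ → Set
Conclusion D d l =
  Graphic l × (∀ x → x ∈ l ⇔ x ∈ D) × (∀ ℓ → IsLq D ℓ → sum l < 2 * ℓ + 2 * d)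

even-* : ∀ m n → evenᵇ n ≡ true → evenᵇ (m * n) ≡ true
even-* zero    n e = refl
even-* (suc m) n e = trans (even-even+ n (m * n) e) (even-* m n e)

-- Case (a): the parity correction

copiesA : ℕ → ℕ → ℕ → ℕ
copiesA σ c d = if evenᵇ d then c else (if evenᵇ (σ + c * d) then c else suc c)

-- Copies of an even d leave the even total even; for an odd d, one further copy flips the parity
-- when needed.
copiesA-spec : ∀ σ c d → evenᵇ σ ≡ true ⊎ evenᵇ d ≡ false →
  c ≤ copiesA σ c d × copiesA σ c d ≤ suc c × evenᵇ (σ + copiesA σ c d * d) ≡ true
copiesA-spec σ c d h with evenᵇ d in ed
copiesA-spec σ c d (inj₁ eσ) | true  = ≤-refl , n≤1+n c , trans (even-even+ σ (c * d) eσ) (even-* c d ed)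
copiesA-spec σ c d h         | false with evenᵇ (σ + c * d) in et
... | true  = ≤-refl , n≤1+n c , et
... | false = n≤1+n c , ≤-refl , trans (cong evenᵇ (rotate σ d (c * d))) (trans (even-odd+ d _ ed) (cong not et))
  where
  rotate : ∀ σ d e → σ + (d + e) ≡ d + (σ + e)
  rotate = solve-∀

-- The slack 2d is made up of one d from the rounding in c and one from the possible extra copy.
sum-extension-< : ∀ s c C d ℓ → C ≤ suc c → sum s + c * d < 2 * ℓ + d → sum (s ++ replicate C d) < 2 * ℓ + 2 * d
sum-extension-< s c C d ℓ C≤sc h = begin-strict
  sum (s ++ replicate C d)     ≡⟨ sum-++-replicate s C d ⟩
  sum s + C * d                ≤⟨ +-monoʳ-≤ (sum s) (*-monoˡ-≤ d C≤sc) ⟩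
  sum s + (d + c * d)          ≡⟨ regroup₁ (sum s) d (c * d) ⟩
  sum s + c * d + d            <⟨ +-monoˡ-< d h ⟩
  2 * ℓ + d + d                ≡⟨ regroup₂ (2 * ℓ) d ⟩
  2 * ℓ + 2 * d                ∎
  where
  open ≤-Reasoning
  regroup₁ : ∀ s d e → s + (d + e) ≡ s + e + d
  regroup₁ = solve-∀
  regroup₂ : ∀ x d → x + d + d ≡ x + 2 * d
  regroup₂ = solve-∀

case-a : ∀ x xs d → Linked _>_ (x ∷ xs ++ [ d ]) → All (_> 0) (x ∷ xs ++ [ d ]) →
         evenᵇ (sum (x ∷ xs ++ [ d ])) ≡ true ⊎ evenᵇ d ≡ false →
         Conclusion (x ∷ xs ++ [ d ]) d (sbarA (x ∷ xs) d)
case-a x xs d lnk pos parity = subst (Conclusion D d) (sym sbarA≡)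
  ( graphic-extension ys d C z<s lnk≥ (λ k 1≤k k≤ys → ≤-trans (proj₁ spec k 1≤k (subst (k ≤_) (sym M≡) k≤ys)) (+-monoʳ-≤ (egRight D k) (*-monoˡ-≤ (k ⊓ d) c≤C))) even
  , ∈-++-replicate C (∈-++⁺ʳ ys (here refl))
  , bound )
  where
  ys = x ∷ xs
  D = ys ++ [ d ]
  M = length D ∸ 1
  c = ℤ.∣ maxK (term D d) M ∣
  C = copiesA (sum D) c d
  lnk≥ : Linked _≥_ D
  lnk≥ = Linked.map <⇒≤ lnk
  0<d : 0 < d
  0<d = All.lookup pos (∈-++⁺ʳ ys (here refl))
  -- The range of the maximum, up to n - 1, covers exactly the positions before the final d.
  M≡ : M ≡ length ys
  M≡ = trans (length-++ xs) (+-comm (length xs) 1)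
  spec = copies-spec D d M 0<d (subst (1 ≤_) (sym M≡) z<s)
           (first-inequality D (≤-trans (m∸n≤m (length D) 1) (decreasing⇒length≤first lnk pos)))
  c≤C = proj₁ (copiesA-spec (sum D) c d parity)
  C≤sc = proj₁ (proj₂ (copiesA-spec (sum D) c d parity))
  even = proj₂ (proj₂ (copiesA-spec (sum D) c d parity))
  sbarA≡ : sbarA ys d ≡ D ++ replicate C d
  sbarA≡ = trans (cong (λ m → ys ++ replicate m d) (+-comm C 1)) (sym (++-assoc ys [ d ] (replicate C d)))
  bound : ∀ ℓ → IsLq D ℓ → sum (D ++ replicate C d) < 2 * ℓ + 2 * d
  bound ℓ ((p , G , degrees , refl) , _) with representatives G D (decreasing⇒unique lnk) degrees
  ... | vs , rest , eq , perm = sum-extension-< D c C d (edges G) C≤sc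
    (bound-extension G d c D vs rest 0<d perm (subst (Pointwise _≤_ D) (sym eq) (Pointwise.refl ≤-refl))
      (last-minimal ys d lnk≥) (λ v → All.lookup (last-minimal ys d lnk≥) (proj₁ degrees v))
      (let k , 1≤k , k≤M , lt = proj₂ spec in k , 1≤k , ≤-trans k≤M (m∸n≤m (length D) 1) , lt))

-- Case (b): doubling the smallest odd element

-- The alternative without odd terms carries an even sum, which contradicts the hypothesis of case
-- (b). Since d is even, the last odd term lies in X, and everything after it is even.
lastOddPos-split : ∀ X d → evenᵇ d ≡ true →
  (lastOddPos (X ++ [ d ]) ≡ 0 × evenᵇ (sum (X ++ [ d ])) ≡ true × All (λ y → evenᵇ y ≡ true) X)
  ⊎ (∃ λ pre → ∃₂ λ v post → X ≡ pre ++ v ∷ post × lastOddPos (X ++ [ d ]) ≡ suc (length pre)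
       × evenᵇ v ≡ false × All (λ y → evenᵇ y ≡ true) post)
lastOddPos-split [] d even-d rewrite even-d = inj₁ (refl , trans (cong evenᵇ (+-identityʳ d)) even-d , [])
lastOddPos-split (x ∷ X) d even-d with lastOddPos (X ++ [ d ]) | lastOddPos-split X d even-d
... | .(suc (length pre)) | inj₂ (pre , v , post , refl , refl , odd-v , even-post) =
  inj₂ (x ∷ pre , v , post , refl , refl , odd-v , even-post)
... | .0 | inj₁ (refl , even-sum , even-X) with evenᵇ x in ex
...   | true  = inj₁ (refl , trans (even-even+ x _ ex) even-sum , ex ∷ even-X)
...   | false = inj₂ ([] , x , X , refl , refl , ex , even-X)

odd-member : ∀ {A : Set} (f : A → ℕ) xs → evenᵇ (sum (map f xs)) ≡ false → ∃ λ x → x ∈ xs × evenᵇ (f x) ≡ false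
odd-member f (x ∷ xs) odd with evenᵇ (f x) in ex
... | false = x , here refl , ex
... | true with odd-member f xs (trans (sym (even-even+ (f x) _ ex)) odd)
...   | y , y∈xs , oy = y , there y∈xs , oy

take-suc-length : ∀ {A : Set} (pre : List A) v q → take (suc (length pre)) (pre ++ v ∷ q) ≡ pre ++ [ v ]
take-suc-length []        v q = refl
take-suc-length (x ∷ pre) v q = cong (x ∷_) (take-suc-length pre v q)

take-length : ∀ {A : Set} (pre q : List A) → take (length pre) (pre ++ q) ≡ pre
take-length []        q = refl
take-length (x ∷ pre) q = cong (x ∷_) (take-length pre q)

drop-length : ∀ {A : Set} (pre q : List A) → drop (length pre) (pre ++ q) ≡ q
drop-length []        q = refl
drop-length (x ∷ pre) q = drop-length pre q

-- By parity some vertex outside a system of representatives has odd degree, hence degree at least v;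
-- it is matched with the second copy of v.
representatives-odd : ∀ {p} (G : SimpleGraph p) pre v q → Linked _>_ (pre ++ v ∷ q) →
  evenᵇ (sum (pre ++ v ∷ q)) ≡ false → All (λ y → evenᵇ y ≡ true) q → HasDegreeSet G (pre ++ v ∷ q) →
  ∃₂ λ vs rest → Pointwise _≤_ (pre ++ v ∷ v ∷ q) (map (degree G) vs) × vs ++ rest ↭ allFin p
representatives-odd {p} G pre v q lnk odd even-q degrees
  with representatives G (pre ++ v ∷ q) (decreasing⇒unique lnk) degrees
... | vs , rest , eq , perm with odd-member (degree G) rest odd-rest
  where
  odd-rest : evenᵇ (sum (map (degree G) rest)) ≡ false
  odd-rest with evenᵇ (sum (map (degree G) rest)) in er
  ... | false = refl
  ... | true with trans (sym (even-n+n (edges G))) (trans (cong evenᵇ (trans (sym (handshake G)) total)) (trans (even-odd+ (sum (pre ++ v ∷ q)) _ odd) (cong not er)))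
    where
    total : sum (map (degree G) (allFin p)) ≡ sum (pre ++ v ∷ q) + sum (map (degree G) rest)
    total = trans (sym (sum-map-↭ (degree G) perm)) (trans (sum-map-++ (degree G) vs rest)
              (cong (λ l → sum l + sum (map (degree G) rest)) eq))
  ...   | ()
... | u , u∈rest , odd-u with ∈-∃++ u∈rest
...   | r₁ , r₂ , refl = vs₁ ++ u ∷ vs₂ , r₁ ++ r₂ , matched , perm′
  where
  deg = degree G
  vs₁ = take (length pre) vs
  vs₂ = drop (length pre) vs
  -- All of q is even, so an odd degree is v itself or one of the larger elements in `pre`.
  v≤u : v ≤ deg u
  v≤u with ∈-++⁻ pre (proj₁ degrees u)
  ... | inj₁ u∈pre       = All.lookup (linked⇒All≥ pre v q (Linked.map <⇒≤ lnk)) u∈pre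
  ... | inj₂ (here eq)   = ≤-reflexive (sym eq)
  ... | inj₂ (there u∈q) with trans (sym odd-u) (All.lookup even-q u∈q)
  ...   | ()
  -- The vertex u is inserted just before the representative of v, so its degree faces one of the
  -- two equal copies of v and all other positions agree exactly.
  map-deg : map deg (vs₁ ++ u ∷ vs₂) ≡ pre ++ deg u ∷ v ∷ q
  map-deg = trans (map-++ deg vs₁ (u ∷ vs₂)) (cong₂ (λ l r → l ++ deg u ∷ r)
    (trans (sym (take-map (length pre) vs)) (trans (cong (take (length pre)) eq) (take-length pre (v ∷ q))))
    (trans (sym (drop-map (length pre) vs)) (trans (cong (drop (length pre)) eq) (drop-length pre (v ∷ q)))))
  matched : Pointwise _≤_ (pre ++ v ∷ v ∷ q) (map deg (vs₁ ++ u ∷ vs₂))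
  matched = subst (Pointwise _≤_ (pre ++ v ∷ v ∷ q)) (sym map-deg)
    (Pointwise.++⁺ˡ ≤-refl pre (v≤u ∷ Pointwise.refl ≤-refl))
  perm′ : (vs₁ ++ u ∷ vs₂) ++ r₁ ++ r₂ ↭ allFin p
  perm′ = ↭-trans (↭-reflexive (++-assoc vs₁ (u ∷ vs₂) (r₁ ++ r₂)))
         (↭-trans (shift u vs₁ (vs₂ ++ r₁ ++ r₂))
         (↭-trans (prep u (↭-reflexive (trans (sym (++-assoc vs₁ vs₂ (r₁ ++ r₂)))
                     (trans (cong (_++ r₁ ++ r₂) (take++drop≡id (length pre) vs)) (sym (++-assoc vs r₁ r₂))))))
         (↭-trans (↭-sym (shift u (vs ++ r₁) r₂))
         (↭-trans (↭-reflexive (++-assoc vs r₁ (u ∷ r₂))) perm))))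

case-b : ∀ X d → Linked _>_ (X ++ [ d ]) → All (_> 0) (X ++ [ d ]) →
         evenᵇ (sum (X ++ [ d ])) ≡ false → evenᵇ d ≡ true →
         Conclusion (X ++ [ d ]) d (sbarB X d)
case-b X d lnk pos odd even-d with lastOddPos-split X d even-d
... | inj₁ (_ , even , _) with trans (sym odd) even
...   | ()
case-b X d lnk pos odd even-d | inj₂ (pre , v , post , refl , r≡ , odd-v , even-post) =
  subst (Conclusion D d) (sym sbarB≡)
  ( graphic-extension ys d c 0<ys lnk-s (λ k 1≤k k≤ys → proj₁ spec k 1≤k (subst (k ≤_) (sym M≡) k≤ys)) even
  , (λ x → mk⇔ (λ x∈ → undup (Equivalence.to (∈-++-replicate c d∈s x) x∈)) (λ x∈ → ∈-++⁺ˡ (dup x∈)))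
  , bound )
  where
  D = (pre ++ v ∷ post) ++ [ d ]
  q = post ++ [ d ]
  ys = pre ++ v ∷ v ∷ post
  s = ys ++ [ d ]
  M = length D
  c = ℤ.∣ maxK (term s d) M ∣
  D≡ : D ≡ pre ++ v ∷ q
  D≡ = ++-assoc pre (v ∷ post) [ d ]
  s≡ : s ≡ pre ++ v ∷ v ∷ q
  s≡ = ++-assoc pre (v ∷ v ∷ post) [ d ]
  lnk-D : Linked _>_ (pre ++ v ∷ q)
  lnk-D = subst (Linked _>_) D≡ lnk
  lnk-s : Linked _≥_ s
  lnk-s = subst (Linked _≥_) (sym s≡) (linked-duplicate pre v q (Linked.map <⇒≤ lnk-D))
  d∈s : d ∈ s
  d∈s = ∈-++⁺ʳ ys (here refl)
  0<d : 0 < d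
  0<d = All.lookup pos (∈-++⁺ʳ (pre ++ v ∷ post) (here refl))
  undup : ∀ {x} → x ∈ s → x ∈ D
  undup {x} x∈s with ∈-++⁻ pre (subst (x ∈_) s≡ x∈s)
  ... | inj₁ x∈pre      = subst (x ∈_) (sym D≡) (∈-++⁺ˡ x∈pre)
  ... | inj₂ (here eq)  = subst (x ∈_) (sym D≡) (∈-++⁺ʳ pre (here eq))
  ... | inj₂ (there x∈) = subst (x ∈_) (sym D≡) (∈-++⁺ʳ pre x∈)
  dup : ∀ {x} → x ∈ D → x ∈ s
  dup {x} x∈D with ∈-++⁻ pre (subst (x ∈_) D≡ x∈D)
  ... | inj₁ x∈pre = subst (x ∈_) (sym s≡) (∈-++⁺ˡ x∈pre)
  ... | inj₂ x∈    = subst (x ∈_) (sym s≡) (∈-++⁺ʳ pre (there x∈))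
  -- Doubling v gives s one term more than D, so the range up to n again ends just before the final
  -- d.
  M≡ : M ≡ length ys
  M≡ = trans (length-++ (pre ++ v ∷ post)) (trans (+-comm _ 1) (trans (cong suc (length-++ pre))
        (trans (sym (+-suc (length pre) _)) (sym (length-++ pre)))))
  0<ys : 0 < length ys
  0<ys = subst (0 <_) (sym (length-++ pre)) (≤-trans z<s (m≤n+m _ (length pre)))
  sum-s : sum s ≡ v + sum D
  sum-s = trans (cong sum s≡) (trans (sum-++ pre (v ∷ v ∷ q)) (trans (rotate (sum pre) v (v + sum q))
            (cong (v +_) (sym (trans (cong sum D≡) (sum-++ pre (v ∷ q)))))))
    where
    rotate : ∀ a b c → a + (b + c) ≡ b + (a + c)
    rotate = solve-∀
  -- The second copy of the odd v makes the odd sum of D even, and copies of the even d keep it so.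
  -- This is why v is doubled and no further correction follows.
  even : evenᵇ (sum s + c * d) ≡ true
  even = trans (even-even+ (sum s) (c * d) (trans (cong evenᵇ sum-s) (trans (even-odd+ v (sum D) odd-v) (cong not odd))))
               (even-* c d even-d)
  -- With n + 1 terms in s, the full bound of n on the largest element is used up.
  first : length s ∸ 1 ≤ sum (take 1 s)
  first = begin
    length s ∸ 1                    ≡⟨ cong (_∸ 1) (trans (length-++ ys) (+-comm _ 1)) ⟩
    length ys                       ≡⟨ M≡ ⟨
    length D                        ≤⟨ decreasing⇒length≤first lnk pos ⟩
    sum (take 1 D)                  ≡⟨ cong (sum ∘ take 1) D≡ ⟩
    sum (take 1 (pre ++ v ∷ q))     ≡⟨ take-1 pre ⟩
    sum (take 1 (pre ++ v ∷ v ∷ q)) ≡⟨ cong (sum ∘ take 1) s≡ ⟨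
    sum (take 1 s)                  ∎
    where
    open ≤-Reasoning
    take-1 : ∀ pre → sum (take 1 (pre ++ v ∷ q)) ≡ sum (take 1 (pre ++ v ∷ v ∷ q))
    take-1 []      = refl
    take-1 (_ ∷ _) = refl
  spec = copies-spec s d M 0<d (subst (1 ≤_) (sym M≡) 0<ys) (first-inequality s first)
  -- For r = `suc (length pre)`, the pieces `take r` and `drop (r ∸ 1)` overlap in v alone, which is
  -- thereby doubled.
  sbarB≡ : sbarB (pre ++ v ∷ post) d ≡ s ++ replicate c d
  sbarB≡ = cong (λ s → s ++ replicate ℤ.∣ maxK (term s d) M ∣ d)
    (trans (cong (λ r → take r D ++ drop (r ∸ 1) D) r≡)
    (trans (cong (λ D → take (suc (length pre)) D ++ drop (length pre) D) D≡)
    (trans (cong₂ _++_ (take-suc-length pre v q) (drop-length pre (v ∷ q)))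
    (trans (++-assoc pre [ v ] (v ∷ q)) (sym s≡)))))
  bound : ∀ ℓ → IsLq D ℓ → sum (s ++ replicate c d) < 2 * ℓ + 2 * d
  bound ℓ ((p , G , degrees , refl) , _)
    with representatives-odd G pre v q lnk-D (trans (cong (evenᵇ ∘ sum) (sym D≡)) odd)
           (All.++⁺ even-post (even-d ∷ [])) (subst (HasDegreeSet G) D≡ degrees)
  ... | vs , rest , matched , perm = sum-extension-< s c c d (edges G) (n≤1+n c)
    (bound-extension G d c s vs rest 0<d perm (subst (λ l → Pointwise _≤_ l (map (degree G) vs)) (sym s≡) matched)
      (last-minimal ys d lnk-s) (λ w → All.lookup (last-minimal ys d lnk-s) (dup (proj₁ degrees w)))
      (let k , 1≤k , k≤M , lt = proj₂ spec in k , 1≤k , ≤-trans k≤M (≤-trans (≤-reflexive M≡) (subst (length ys ≤_) (sym (length-++ ys)) (m≤m+n _ 1))) , lt))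

theorem9 : (x : ℕ) (xs : List ℕ) (dn : ℕ) →
    Linked _>_ (x ∷ xs ++ [ dn ]) →
    All (λ d → d > 0) (x ∷ xs ++ [ dn ]) →
    Graphic (sbar (x ∷ xs) dn)
    × (∀ d → d ∈ sbar (x ∷ xs) dn ⇔ d ∈ (x ∷ xs ++ [ dn ]))
    × (∀ ℓ → IsLq (x ∷ xs ++ [ dn ]) ℓ → sum (sbar (x ∷ xs) dn) < 2 * ℓ + 2 * dn)
theorem9 x xs dn lnk pos = branch (evenᵇ (sum D)) (evenᵇ dn) refl refl
  where
  D = x ∷ xs ++ [ dn ]
  -- Generalising over both booleans lets the `if` in `sbar` compute while the equations retain the
  -- parities.
  branch : ∀ b₁ b₂ → evenᵇ (sum D) ≡ b₁ → evenᵇ dn ≡ b₂ →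
           Conclusion D dn (if b₁ ∨ not b₂ then sbarA (x ∷ xs) dn else sbarB (x ∷ xs) dn)
  branch true  _     e₁ e₂ = case-a x xs dn lnk pos (inj₁ e₁)
  branch false false e₁ e₂ = case-a x xs dn lnk pos (inj₂ e₂)
  branch false true  e₁ e₂ = case-b (x ∷ xs) dn lnk pos e₁ e₂
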